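{- (i) $\lnot[\mathrm{UVAL}_2]=[\mathrm{UVAL}_2]$. (ii) $\mathrm{MaxVAL}\propto\mathrm{UVAL}_2$.
   Context: $\Sigma=\{0,1\}$; $\Sigma^*$ is the set of finite nonempty binary strings. For $x\in\Sigma^m$ write $x=(x_1,\dots,x_m)$, $\pi_1(x)=x_1$, $\lnot x$ its bitwise complement. $\Sigma^m$ is ordered lexicographically with $x_1$ most significant. Let $\mathbb{P}_+\Sigma=\{\{0\},\{1\},\Sigma\}$ with $\lnot\{0\}=\{1\}$, $\lnot\{1\}=\{0\}$, $\lnot\Sigma=\Sigma$. A promise problem is a function $\phi:\Sigma^*\to\mathbb{P}_+\Sigma$. For promise problems, $\phi_1\propto\phi_2$ means there is a polynomial-time computable $\mu:\Sigma^*\to\Sigma^*$ with $\phi_1(x)\supseteq\phi_2(\mu(x))$ for all $x$; $[\phi]=\{\phi_1:\phi_1\propto\phi\}$; $(\lnot\phi)(x)=\lnot(\phi(x))$ and $\lnot[\phi]:=[\lnot\phi]$. $\mathrm{MaxVAL}$ takes an encoding (e.g. $m$ in binary plus a Boolean formula over $\land,\lor,\lnot$) of $f:\Sigma^m\to\Sigma$ and $\mathrm{MaxVAL}(f)=\{\pi_1\max\{x:f(x)=1\}\}$ if $\exists x:f(x)=1$, and $\Sigma$ otherwise. $\mathrm{UVAL}_2$ takes an encoding of $f:\Sigma^m\times\Sigma^{m'}\to\Sigma$, written $f(x,y)$, and $\mathrm{UVAL}_2(f)=\{\pi_1x:\forall y,\ f(x,y)=1\}$ if there is exactly one $x\in\Sigma^m$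 with $\forall y\in\Sigma^{m'},\ f(x,y)=1$, and $\Sigma$ otherwise. -}

module Defs where

open import Data.Bool.Base using (Bool; true; false; not; _∧_; _∨_)
import Data.Bool.Base as Bool
import Data.Bool.Properties as Bool
open import Data.Empty using (⊥-elim)
open import Data.Fin.Base using (Fin; toℕ; fromℕ<)
open import Data.Fin.Properties using (toℕ<n; fromℕ<-toℕ)
open import Data.List.Base as List using (List; []; _∷_; _++_; replicate)
open import Data.List.NonEmpty using (List⁺; _∷_; length; toList)
open import Data.List.Properties using (++-assoc)
open import Data.Maybe.Base using (Maybe; just; nothing; maybe; _>>=_)
open import Data.Nat.Base using (ℕ; zero; suc; _+_; _*_; _^_; _≤_)
open import Data.Nat.Properties using (_<?_; +-identityʳ; +-suc)
open import Data.Product using (_×_; _,_; proj₁; ∃; ∃₂; ∃!)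
open import Data.Unit.Base using (tt)
open import Data.Vec.Base as Vec using (Vec; []; _∷_; head; lookup; zipWith)
import Data.Vec.Properties as Vec
import Data.Vec.Relation.Binary.Lex.Strict as Lex
open import Function.Base using (_∘_)
open import Level using (0ℓ)
open import Relation.Binary.PropositionalEquality
  using (_≡_; refl; sym; trans; cong)
open import Relation.Nullary.Decidable
  using (Dec; yes; no; map′; _×-dec_; _→-dec_)
open import Relation.Unary using (Pred; Decidable)

------------------------------------------------------------------------
-- Promise problems

Σ⁺ : Set
Σ⁺ = List⁺ Bool

-- The nonempty subsets of {0,1}.
data ℙ₊ : Set where
  ⁅_⁆  : Bool → ℙ₊
  full : ℙ₊

data _∈_ (b : Bool) : ℙ₊ → Set where
  single : b ∈ ⁅ b ⁆
  any    : b ∈ full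

_⊇_ : ℙ₊ → ℙ₊ → Set
S ⊇ T = ∀ b → b ∈ T → b ∈ S

neg : ℙ₊ → ℙ₊
neg ⁅ b ⁆ = ⁅ not b ⁆
neg full  = full

PromiseProblem : Set
PromiseProblem = Σ⁺ → ℙ₊

∼_ : PromiseProblem → PromiseProblem
(∼ φ) w = neg (φ w)

------------------------------------------------------------------------
-- Deterministic multi-tape Turing machines over the tape alphabet {0,1,␣}

Sym : Set
Sym = Maybe Bool

pattern ␣ = nothing

data Move : Set where
  left stay right : Move

-- A two-way infinite tape: the cells left of the head (nearest first), the
-- scanned cell, and the cells right of the head.  Cells beyond either list
-- are blank.
record Tape : Set where
  constructor tape
  field
    before : List Sym
    scan   : Sym
    after  : List Sym

-- Not storing outermost blanks keeps the representation of a tape unique.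
push : Sym → List Sym → List Sym
push (just b) cs       = just b ∷ cs
push ␣        []       = []
push ␣        (c ∷ cs) = ␣ ∷ c ∷ cs

move : Move → Tape → Tape
move left  (tape []       s rs) = tape [] ␣ (push s rs)
move left  (tape (l ∷ ls) s rs) = tape ls l (push s rs)
move stay  t                    = t
move right (tape ls s [])       = tape (push s ls) ␣ []
move right (tape ls s (r ∷ rs)) = tape (push s ls) r rs

act : Sym × Move → Tape → Tape
act (s , d) (tape ls _ rs) = move d (tape ls s rs)

upToBlank : List Sym → List Bool
upToBlank []            = []
upToBlank (␣ ∷ _)       = []
upToBlank (just b ∷ cs) = b ∷ upToBlank cs

record TM : Set where
  field
    extraTapes : ℕ
    states     : ℕ
  tapes : ℕ
  tapes = suc extraTapes
  field
    start : Fin states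
    -- nothing: halt
    δ     : Fin states → Vec Sym tapes →
            Maybe (Fin states × Vec (Sym × Move) tapes)

module _ (M : TM) where
  open TM M

  Config : Set
  Config = Fin states × Vec Tape tapes

  step : Config → Maybe Config
  step (q , ts) with δ q (Vec.map Tape.scan ts)
  ... | nothing       = nothing
  ... | just (r , as) = just (r , zipWith act as ts)

  data HaltsIn : ℕ → Config → Config → Set where
    halt : ∀ {C} → step C ≡ nothing → HaltsIn 0 C C
    next : ∀ {t C C′ D} → step C ≡ just C′ → HaltsIn t C′ D →
           HaltsIn (suc t) C D

  initial : Σ⁺ → Config
  initial (b ∷ bs) =
    start , tape [] (just b) (List.map just bs) ∷ Vec.replicate _ (tape [] ␣ [])

  -- The first tape serves for input and output; the output starts at the head.
  output : Config → List Bool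
  output (_ , tape _ s rs ∷ _) = upToBlank (s ∷ rs)

-- Time O(nᵏ); inputs are nonempty, so no additive constant is needed.
PolyTime : (Σ⁺ → Σ⁺) → Set
PolyTime μ =
  ∃ λ (M : TM) → ∃₂ λ (c k : ℕ) → ∀ w →
    ∃₂ λ t C → t ≤ c * length w ^ k
             × HaltsIn M t (initial M w) C
             × output M C ≡ toList (μ w)

------------------------------------------------------------------------
-- Reductions and classes

infix 4 _∝_

_∝_ : PromiseProblem → PromiseProblem → Set
φ₁ ∝ φ₂ = ∃ λ (μ : Σ⁺ → Σ⁺) → PolyTime μ × (∀ x → φ₁ x ⊇ φ₂ (μ x))

[_] : PromiseProblem → Pred PromiseProblem 0ℓ
[ φ ] φ₁ = φ₁ ∝ φ

¬[_] : PromiseProblem → Pred PromiseProblem 0ℓ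
¬[ φ ] = [ ∼ φ ]

------------------------------------------------------------------------
-- Finite search over Boolean vectors

any? : ∀ {m} {P : Pred (Vec Bool m) 0ℓ} → Decidable P → Dec (∃ P)
any? {zero}  P? = map′ ([] ,_) (λ { ([] , p) → p }) (P? [])
any? {suc m} P? with any? (P? ∘ (true ∷_)) | any? (P? ∘ (false ∷_))
... | yes (x , p) | _           = yes (true ∷ x , p)
... | no _        | yes (x , p) = yes (false ∷ x , p)
... | no ¬t       | no ¬f       =
  no λ { (true ∷ x , p) → ¬t (x , p) ; (false ∷ x , p) → ¬f (x , p) }

all? : ∀ {m} {P : Pred (Vec Bool m) 0ℓ} → Decidable P → Dec (∀ x → P x)
all? {zero}  P? = map′ (λ { p [] → p }) (λ p → p []) (P? [])
all? {suc m} P? =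
  map′ (λ { (t , f) (true ∷ x) → t x ; (t , f) (false ∷ x) → f x })
       (λ p → p ∘ (true ∷_) , p ∘ (false ∷_))
       (all? (P? ∘ (true ∷_)) ×-dec all? (P? ∘ (false ∷_)))

unique? : ∀ {m} {P : Pred (Vec Bool m) 0ℓ} → Decidable P → Dec (∃! _≡_ P)
unique? P? =
  map′ (λ (x , p , u) → x , p , λ {y} → u y)
       (λ (x , p , u) → x , p , λ y → u {y})
       (any? λ x → P? x ×-dec all? λ y → P? y →-dec Vec.≡-dec Bool._≟_ x y)

------------------------------------------------------------------------
-- MaxVAL and UVAL₂ on Boolean functions

_≤ₗₑₓ_ : ∀ {m} → Vec Bool m → Vec Bool m → Set
_≤ₗₑₓ_ = Lex.Lex-≤ _≡_ Bool._<_

IsMax : ∀ {m} → (Vec Bool m → Bool) → Vec Bool m → Set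
IsMax f x = f x ≡ true × (∀ y → f y ≡ true → y ≤ₗₑₓ x)

sat? : ∀ {m} (f : Vec Bool m → Bool) → Dec (∃ λ x → f x ≡ true)
sat? f = any? λ x → f x Bool.≟ true

maximum : ∀ {m} (f : Vec Bool m → Bool) → (∃ λ x → f x ≡ true) → ∃ (IsMax f)
maximum {zero}  f ([] , p) = [] , p , λ { [] _ → Lex.base tt }
maximum {suc m} f s with sat? (f ∘ (true ∷_)) | s
... | yes s′ | _ = let x , p , u = maximum (f ∘ (true ∷_)) s′ in
  true ∷ x , p , λ { (true  ∷ y) q → Lex.next refl (u y q)
                   ; (false ∷ y) _ → Lex.this Bool.f<t refl }
... | no ¬s  | true ∷ x , p = ⊥-elim (¬s (x , p))
... | no ¬s  | false ∷ x , p = let z , q , u = maximum (f ∘ (false ∷_)) (x , p) in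
  false ∷ z , q , λ { (true  ∷ y) r → ⊥-elim (¬s (y , r))
                    ; (false ∷ y) r → Lex.next refl (u y r) }

-- Sizes are suc m because Σᵐ consists of nonempty strings.
maxVAL : ∀ {m} → (Vec Bool (suc m) → Bool) → ℙ₊
maxVAL f with sat? f
... | yes s = ⁅ head (proj₁ (maximum f s)) ⁆
... | no _  = full

uVAL₂ : ∀ {m m′} → (Vec Bool (suc m) → Vec Bool m′ → Bool) → ℙ₊
uVAL₂ f with unique? (λ x → all? λ y → f x y Bool.≟ true)
... | yes (x , _) = ⁅ head x ⁆
... | no _        = full

------------------------------------------------------------------------
-- Boolean formulas and their encoding

data Formula (m m′ : ℕ) : Set where
  x⟨_⟩      : Fin m → Formula m m′
  y⟨_⟩      : Fin m′ → Formula m m′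
  ~_        : Formula m m′ → Formula m m′
  _∧′_ _∨′_ : Formula m m′ → Formula m m′ → Formula m m′

eval : ∀ {m m′} → Formula m m′ → Vec Bool m → Vec Bool m′ → Bool
eval x⟨ i ⟩   x y = lookup x i
eval y⟨ j ⟩   x y = lookup y j
eval (~ φ)    x y = not (eval φ x y)
eval (φ ∧′ ψ) x y = eval φ x y ∧ eval ψ x y
eval (φ ∨′ ψ) x y = eval φ x y ∨ eval ψ x y

pattern O = false
pattern I = true

-- Postfix notation; the variable with index i is written as a marker for its
-- sort followed by 1ⁱ0.
code : ∀ {m m′} → Formula m m′ → List Bool
code x⟨ i ⟩   = I ∷ I ∷ O ∷ replicate (toℕ i) I ++ O ∷ []
code y⟨ j ⟩   = I ∷ I ∷ I ∷ replicate (toℕ j) I ++ O ∷ []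
code (~ φ)    = code φ ++ O ∷ O ∷ []
code (φ ∧′ ψ) = code φ ++ code ψ ++ O ∷ I ∷ []
code (φ ∨′ ψ) = code φ ++ code ψ ++ I ∷ O ∷ []

-- The list of formulas is the stack of operands read so far; parseX and parseY
-- also count the 1s read of a variable.
module _ {m m′ : ℕ} where

  parse : List Bool → List (Formula m m′) → Maybe (Formula m m′)
  parseX parseY : List Bool → ℕ → List (Formula m m′) → Maybe (Formula m m′)

  parse []              (φ ∷ [])    = just φ
  parse (O ∷ O ∷ w)     (φ ∷ s)     = parse w (~ φ ∷ s)
  parse (O ∷ I ∷ w)     (ψ ∷ φ ∷ s) = parse w (φ ∧′ ψ ∷ s)
  parse (I ∷ O ∷ w)     (ψ ∷ φ ∷ s) = parse w (φ ∨′ ψ ∷ s)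
  parse (I ∷ I ∷ O ∷ w) s           = parseX w 0 s
  parse (I ∷ I ∷ I ∷ w) s           = parseY w 0 s
  parse _               _           = nothing

  parseX []      i s = nothing
  parseX (I ∷ w) i s = parseX w (suc i) s
  parseX (O ∷ w) i s with i <? m
  ... | yes i<m = parse w (x⟨ fromℕ< i<m ⟩ ∷ s)
  ... | no _    = nothing

  parseY []      j s = nothing
  parseY (I ∷ w) j s = parseY w (suc j) s
  parseY (O ∷ w) j s with j <? m′
  ... | yes j<m′ = parse w (y⟨ fromℕ< j<m′ ⟩ ∷ s)
  ... | no _     = nothing

  parseX-1ⁱ0 : ∀ (i : Fin m) n k w s → k + n ≡ toℕ i →
               parseX ((replicate n I ++ O ∷ []) ++ w) k s ≡ parse w (x⟨ i ⟩ ∷ s)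
  parseX-1ⁱ0 i zero k w s eq with trans (sym (+-identityʳ k)) eq
  ... | refl with toℕ i <? m
  ...   | yes i<m = cong (λ l → parse w (x⟨ l ⟩ ∷ s)) (fromℕ<-toℕ i i<m)
  ...   | no i≮m  = ⊥-elim (i≮m (toℕ<n i))
  parseX-1ⁱ0 i (suc n) k w s eq =
    parseX-1ⁱ0 i n (suc k) w s (trans (sym (+-suc k n)) eq)

  parseY-1ʲ0 : ∀ (j : Fin m′) n k w s → k + n ≡ toℕ j →
               parseY ((replicate n I ++ O ∷ []) ++ w) k s ≡ parse w (y⟨ j ⟩ ∷ s)
  parseY-1ʲ0 j zero k w s eq with trans (sym (+-identityʳ k)) eq
  ... | refl with toℕ j <? m′
  ...   | yes j<m′ = cong (λ l → parse w (y⟨ l ⟩ ∷ s)) (fromℕ<-toℕ j j<m′)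
  ...   | no j≮m′  = ⊥-elim (j≮m′ (toℕ<n j))
  parseY-1ʲ0 j (suc n) k w s eq =
    parseY-1ʲ0 j n (suc k) w s (trans (sym (+-suc k n)) eq)

  parse-code : ∀ φ w s → parse (code φ ++ w) s ≡ parse w (φ ∷ s)
  parse-code x⟨ i ⟩   w s = parseX-1ⁱ0 i (toℕ i) 0 w s refl
  parse-code y⟨ j ⟩   w s = parseY-1ʲ0 j (toℕ j) 0 w s refl
  parse-code (~ φ)    w s
    rewrite ++-assoc (code φ) (O ∷ O ∷ []) w = parse-code φ _ s
  parse-code (φ ∧′ ψ) w s
    rewrite ++-assoc (code φ) (code ψ ++ O ∷ I ∷ []) w
          | ++-assoc (code ψ) (O ∷ I ∷ []) w =
    trans (parse-code φ _ s) (parse-code ψ _ (φ ∷ s))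
  parse-code (φ ∨′ ψ) w s
    rewrite ++-assoc (code φ) (code ψ ++ I ∷ O ∷ []) w
          | ++-assoc (code ψ) (I ∷ O ∷ []) w =
    trans (parse-code φ _ s) (parse-code ψ _ (φ ∷ s))

-- A number with binary digits b₁…bₙ (most significant first) is written
-- 1b₁…1bₙ0; number 0 returns it together with the rest of the string.
number : ℕ → List Bool → Maybe (ℕ × List Bool)
number n (I ∷ O ∷ w) = number (2 * n) w
number n (I ∷ I ∷ w) = number (1 + 2 * n) w
number n (O ∷ w)     = just (n , w)
number n _           = nothing

-- m, then a formula in x₁,…,xₘ only
decode₁ : Σ⁺ → Maybe (∃ λ m → Formula (suc m) 0)
decode₁ w = do
  suc m , v ← number 0 (toList w) where _ → nothing
  φ ← parse v []
  just (m , φ)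

-- m, then m′, then a formula in x₁,…,xₘ,y₁,…,yₘ′
decode₂ : Σ⁺ → Maybe (∃₂ λ m m′ → Formula (suc m) m′)
decode₂ w = do
  suc m , v ← number 0 (toList w) where _ → nothing
  m′ , u ← number 0 v
  φ ← parse u []
  just (m , m′ , φ)

------------------------------------------------------------------------
-- The promise problems; strings that are not encodings carry no promise

MaxVAL : PromiseProblem
MaxVAL = maybe (λ (m , φ) → maxVAL λ x → eval φ x []) full ∘ decode₁

UVAL₂ : PromiseProblem
UVAL₂ = maybe (λ (m , m′ , φ) → uVAL₂ (eval φ)) full ∘ decode₂

{-# OPTIONS --safe #-}

-- (i) Replacing every variable xᵢ of the formula by its negation complements the
-- first argument, and with it the unique certified x; on postfix encodings this
-- is done by a finite transducer that inserts 00 behind each xᵢ.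
--
-- (ii) Let n be the length of the input.  Every variable of the formula f has an
-- index below n, so that f may be read as a function of n variables, whatever m
-- is, without changing the first bit of its largest model; m itself may be
-- exponential in n.  The largest model is the unique x with
-- f(x) ∧ (¬ f(y) ∨ y ≤ x) for all y, and the order y ≤ x on n bits has a formula
-- of size O(n²).

module Submission where

open import Defs
open import Data.Product using (_×_)
open import Relation.Unary using (_≐_)

import Algebra.Solver.Monoid as MonoidSolver
open import Data.Bool.Base as Bool using (Bool; true; false; not; if_then_else_; _∧_; _∨_)
import Data.Bool.Properties as Bool
open import Data.Empty using (⊥-elim)
open import Data.Fin.Base using (Fin; zero; suc; toℕ; fromℕ<; inject₁)
open import Data.Fin.Patterns
open import Data.Fin.Properties
  using (+↔⊎; *↔×; 1↔⊤; toℕ-inject₁; toℕ-injective; toℕ-fromℕ<; toℕ<n)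
open import Data.List.Base as List using (List; []; _∷_; _++_; _ʳ++_; reverse; replicate)
open import Data.List.NonEmpty as List⁺ using (length; toList; _∷_)
import Data.List.Properties as List
open import Data.Maybe.Base as Maybe using (Maybe; just; nothing; maybe; is-just)
open import Data.Nat.Base
open import Data.Nat.Properties
open import Data.Product.Base using (_,_; proj₁; proj₂; ∃; ∃₂; map₁; map₂)
open import Data.Sum.Base using (_⊎_; inj₁; inj₂)
open import Data.Sum.Function.Propositional using (_⊎-↔_)
open import Data.Unit.Base using (⊤; tt)
open import Data.Vec.Base as Vec using (Vec; []; _∷_; zipWith; head; lookup; tabulate; _[_]≔_)
import Data.Vec.Properties as Vec
import Data.Vec.Relation.Binary.Lex.Strict as Lex
open import Function.Base using (_∘_; id; const)
open import Function.Bundles using (_↔_; Inverse)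
open import Function.Properties.Inverse using (↔-refl; ↔-sym; ↔-trans)
open import Relation.Binary.PropositionalEquality hiding ([_])
open import Relation.Nullary.Decidable using (yes; no)

open MonoidSolver (List.++-monoid Bool) using (solve; _⊕_; _⊜_)

-- `PolyTime` asks for an actual Turing machine, so most of the work is machine building. In (i) the
-- reduction `μ` is arbitrary, and its machine may leave rubbish on its tapes and around its output.
-- The second machine therefore gets three fresh tapes next to the shared first one, copies its
-- input away from there, and writes its own output further to the right, fenced off by a blank on
-- either side. Its running time is measured in the length of `μ w`, which is at most the running
-- time of the first machine plus the length of `w`. In (ii), taking `n` as the number of variables
-- spares the machine any arithmetic on `m`: the length of the input is counted, in binary for the
-- two numbers and in unary for the variables of the order formula. That formula has the comparison
-- of the less significant bits as its left operand, so its postfix code is a fixed string followed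
-- by one block per position, in order of falling index; using up the unary counter produces exactly
-- these indices.

-- Multi-tape machines and their combinators

hd : List Sym → Sym
hd []      = ␣
hd (s ∷ _) = s

tl : List Sym → List Sym
tl []       = []
tl (_ ∷ cs) = cs

infix 6 _▹_

_▹_ : List Sym → List Sym → Tape
ls ▹ rs = tape ls (hd rs) (tl rs)

-- The same as act, but written so that it computes without knowing whether the
-- stored parts of the tape are empty.
act′ : Sym × Move → Tape → Tape
act′ (s , left)  (tape ls _ rs) = tape (tl ls) (hd ls) (push s rs)
act′ (s , stay)  (tape ls _ rs) = tape ls s rs
act′ (s , right) (tape ls _ rs) = push s ls ▹ rs

act≗act′ : ∀ a t → act a t ≡ act′ a t
act≗act′ (s , left)  (tape []       _ rs)      = refl
act≗act′ (s , left)  (tape (_ ∷ _)  _ rs)      = refl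
act≗act′ (s , stay)  t                         = refl
act≗act′ (s , right) (tape _ _ [])             = refl
act≗act′ (s , right) (tape _ _ (_ ∷ _))        = refl

scans : ∀ {k} → Vec Tape k → Vec Sym k
scans = Vec.map Tape.scan

record Machine (k : ℕ) : Set₁ where
  field
    State  : Set
    size   : ℕ
    finite : State ↔ Fin size
    start  : State
    δ      : State → Vec Sym k → Maybe (State × Vec (Sym × Move) k)

open Machine

private variable
  k m m′ n n′ t u : ℕ
  ts us vs        : Vec Tape k

-- The number of steps is an upper bound only: done leaves it open.
data Run (M : Machine k) : ℕ → State M → Vec Tape k → Vec Tape k → Set where
  done : ∀ {s} → δ M s (scans ts) ≡ nothing → Run M t s ts ts
  go   : ∀ {s s′ as} → δ M s (scans ts) ≡ just (s′ , as) →
         Run M t s′ (zipWith act′ as ts) us → Run M (suc t) s ts us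

infix 3 _⊢_⇒⟨_⟩_

_⊢_⇒⟨_⟩_ : Machine k → Vec Tape k → ℕ → Vec Tape k → Set
M ⊢ ts ⇒⟨ t ⟩ us = Run M t (start M) ts us

run-mono : ∀ {M : Machine k} {s} → t ≤ u → Run M t s ts us → Run M u s ts us
run-mono _         (done p) = done p
run-mono (s≤s t≤u) (go p r) = go p (run-mono t≤u r)

idle : Vec Sym k → Vec (Sym × Move) k
idle = Vec.map (_, stay)

act-idle : (ts : Vec Tape k) → zipWith act′ (idle (scans ts)) ts ≡ ts
act-idle []       = refl
act-idle (t ∷ ts) = cong (t ∷_) (act-idle ts)

go-idle : ∀ {M : Machine k} {s s′} →
          δ M s (scans ts) ≡ just (s′ , idle (scans ts)) →
          Run M t s′ ts us → Run M (suc t) s ts us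
go-idle {ts = ts} {t} {us} {M} {s′ = s′} p r =
  go p (subst (λ vs → Run M t s′ vs us) (sym (act-idle ts)) r)

prim : (Vec Sym k → Vec (Sym × Move) k) → Machine k
prim f = record
  { State = Fin 2 ; size = 2 ; finite = ↔-refl ; start = zero
  ; δ = λ { zero v → just (suc zero , f v) ; (suc _) _ → nothing } }

prim-run : (f : Vec Sym k → Vec (Sym × Move) k) →
           prim f ⊢ ts ⇒⟨ 1 ⟩ zipWith act′ (f (scans ts)) ts
prim-run f = go refl (done refl)

skip : Machine k
skip = record
  { State = Fin 1 ; size = 1 ; finite = ↔-refl ; start = zero ; δ = λ _ _ → nothing }

resume : ∀ {A B C : Set} → (A → B) → Maybe (B × C) → Maybe (A × C) → Maybe (B × C)
resume f = maybe (just ∘ map₁ f)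

infixr 6 _⨾_

-- Passing from `M` to `N` takes an idle step of its own, which is the successor in the running
-- times of `⨾-run₁`.
_⨾_ : Machine k → Machine k → Machine k
M ⨾ N = record
  { State  = State M ⊎ State N
  ; size   = size M + size N
  ; finite = ↔-trans (finite M ⊎-↔ finite N) (↔-sym +↔⊎)
  ; start  = inj₁ (start M)
  ; δ      = λ { (inj₁ s) v → resume inj₁ (just (inj₂ (start N) , idle v)) (δ M s v)
               ; (inj₂ s) v → Maybe.map (map₁ inj₂) (δ N s v) } }

module _ {M N : Machine k} where

  ⨾-run₂ : ∀ {s} → Run N t s ts us → Run (M ⨾ N) t (inj₂ s) ts us
  ⨾-run₂ (done p) = done (cong (Maybe.map (map₁ inj₂)) p)
  ⨾-run₂ (go p r) = go (cong (Maybe.map (map₁ inj₂)) p) (⨾-run₂ r)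

  ⨾-run₁ : ∀ {s} → Run M t s ts us → N ⊢ us ⇒⟨ u ⟩ vs →
           Run (M ⨾ N) (suc (t + u)) (inj₁ s) ts vs
  ⨾-run₁ {t} (done p) r =
    go-idle (cong (resume inj₁ _) p) (run-mono (m≤n+m _ t) (⨾-run₂ r))
  ⨾-run₁ (go p q) r = go (cong (resume inj₁ _) p) (⨾-run₁ q r)

  infixr 6 _⨾-run_

  _⨾-run_ : M ⊢ ts ⇒⟨ t ⟩ us → N ⊢ us ⇒⟨ u ⟩ vs → M ⨾ N ⊢ ts ⇒⟨ suc (t + u) ⟩ vs
  _⨾-run_ = ⨾-run₁

while : (Vec Sym k → Bool) → Machine k → Machine k
while c M = record
  { State  = ⊤ ⊎ State M
  ; size   = 1 + size M
  ; finite = ↔-trans (↔-sym 1↔⊤ ⊎-↔ finite M) (↔-sym +↔⊎)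
  ; start  = inj₁ tt
  ; δ      = λ { (inj₁ _) v → if c v then just (inj₂ (start M) , idle v) else nothing
               ; (inj₂ s) v → resume inj₂ (just (inj₁ tt , idle v)) (δ M s v) } }

module _ {c : Vec Sym k → Bool} {M : Machine k} where

  while-stop : c (scans ts) ≡ false → while c M ⊢ ts ⇒⟨ t ⟩ ts
  while-stop p = done (cong (if_then _ else _) p)

  while-body : ∀ {s} → Run M t s ts us → while c M ⊢ us ⇒⟨ u ⟩ vs →
               Run (while c M) (suc (t + u)) (inj₂ s) ts vs
  while-body {t} (done p) r =
    go-idle (cong (resume inj₂ _) p) (run-mono (m≤n+m _ t) r)
  while-body (go p q) r = go (cong (resume inj₂ _) p) (while-body q r)

  while-go : c (scans ts) ≡ true → M ⊢ ts ⇒⟨ t ⟩ us → while c M ⊢ us ⇒⟨ u ⟩ vs →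
             while c M ⊢ ts ⇒⟨ 2 + t + u ⟩ vs
  while-go p q r = go-idle (cong (if_then _ else _) p) (while-body q r)

on : Fin k → Machine 1 → Machine k
on i M = record
  { State = State M ; size = size M ; finite = finite M ; start = start M
  ; δ = λ s v → Maybe.map (map₂ (λ as → idle v [ i ]≔ head as)) (δ M s (lookup v i ∷ [])) }

act-on : ∀ a (i : Fin k) ts →
         zipWith act′ (idle (scans ts) [ i ]≔ a) ts ≡ ts [ i ]≔ act′ a (lookup ts i)
act-on a zero    (t ∷ ts) = cong (_ ∷_) (act-idle ts)
act-on a (suc i) (t ∷ ts) = cong (t ∷_) (act-on a i ts)

on-run : ∀ {M} (i : Fin k) {s T T′} → Run M t s (T ∷ []) (T′ ∷ []) →
         lookup ts i ≡ T → Run (on i M) t s ts (ts [ i ]≔ T′)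
on-run {ts = ts} {M} i {s} (done p) refl
  rewrite Vec.[]≔-lookup ts i =
  done (cong (Maybe.map _) (trans (cong (λ a → δ M s (a ∷ [])) (Vec.lookup-map i Tape.scan ts)) p))
on-run {ts = ts} {M} i {s} (go {as = a ∷ []} p r) refl =
  go (cong (Maybe.map _) (trans (cong (λ b → δ M s (b ∷ [])) (Vec.lookup-map i Tape.scan ts)) p))
     (subst₂ (Run (on i M) _ _) (sym (act-on a i ts)) (Vec.[]≔-idempotent ts i)
       (on-run i r (Vec.lookup∘update i ts _)))

infixl 7 _↑_

_↑_ : Machine k → ∀ e → Machine (k + e)
_↑_ {k} M e = record
  { State = State M ; size = size M ; finite = finite M ; start = start M
  ; δ = λ s v → Maybe.map (map₂ (Vec._++ idle (Vec.drop k v))) (δ M s (Vec.take k v)) }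

take-++ : ∀ {A : Set} (xs : Vec A m) (ys : Vec A n) → Vec.take m (xs Vec.++ ys) ≡ xs
take-++ []       ys = refl
take-++ (x ∷ xs) ys = cong (x ∷_) (take-++ xs ys)

drop-++ : ∀ {A : Set} (xs : Vec A m) (ys : Vec A n) → Vec.drop m (xs Vec.++ ys) ≡ ys
drop-++ []       ys = refl
drop-++ (x ∷ xs) ys = drop-++ xs ys

↑-δ : ∀ (M : Machine k) {e s r} (ts : Vec Tape k) (us : Vec Tape e) →
      δ M s (scans ts) ≡ r →
      δ (M ↑ e) s (scans (ts Vec.++ us)) ≡ Maybe.map (map₂ (Vec._++ idle (scans us))) r
↑-δ M ts us refl
  rewrite Vec.map-++ Tape.scan ts us
        | take-++ (scans ts) (scans us) | drop-++ (scans ts) (scans us) = refl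

↑-run : ∀ {M : Machine k} {e s} (us : Vec Tape e) →
        Run M t s ts vs → Run (M ↑ e) t s (ts Vec.++ us) (vs Vec.++ us)
↑-run {ts = ts} {M = M} us (done p) = done (↑-δ M ts us p)
↑-run {ts = ts} {vs} {M} {e} us (go {as = as} p r) =
  go (↑-δ M ts us p)
     (subst (λ ws → Run (M ↑ e) _ _ ws (vs Vec.++ us))
       (sym (trans (Vec.zipWith-++ act′ as _ ts us)
                   (cong (zipWith act′ as ts Vec.++_) (act-idle us))))
       (↑-run us r))

-- Translation to and from Turing machines

toTM : Machine (suc k) → TM
toTM {k} M = record
  { extraTapes = k
  ; states     = size M
  ; start      = Inverse.to (finite M) (start M)
  ; δ          = λ q v → Maybe.map (map₁ (Inverse.to (finite M))) (δ M (Inverse.from (finite M) q) v) }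

zipWith-act : (as : Vec (Sym × Move) k) (ts : Vec Tape k) →
              zipWith act as ts ≡ zipWith act′ as ts
zipWith-act []       []       = refl
zipWith-act (a ∷ as) (t ∷ ts) = cong₂ _∷_ (act≗act′ a t) (zipWith-act as ts)

module _ {M : TM} where
  open TM M using (tapes)

  step-halts : ∀ {q} {ts : Vec Tape tapes} → TM.δ M q (scans ts) ≡ nothing →
               step M (q , ts) ≡ nothing
  step-halts p rewrite p = refl

  step-moves : ∀ {q r as} {ts : Vec Tape tapes} → TM.δ M q (scans ts) ≡ just (r , as) →
               step M (q , ts) ≡ just (r , zipWith act′ as ts)
  step-moves {as = as} {ts} p rewrite p = cong (λ us → just (_ , us)) (zipWith-act as ts)

toTM-halts : ∀ {M : Machine (suc k)} {s} → Run M t s ts us →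
             ∃₂ λ t′ q → t′ ≤ t × HaltsIn (toTM M) t′ (Inverse.to (finite M) s , ts) (q , us)
toTM-halts {M = M} {s} (done p) =
  0 , _ , z≤n , halt (step-halts (cong (Maybe.map _)
    (trans (cong (λ s → δ M s _) (Inverse.strictlyInverseʳ (finite M) s)) p)))
toTM-halts {M = M} {s} (go p r) =
  let t′ , q , t′≤t , h = toTM-halts r in
  suc t′ , q , s≤s t′≤t ,
  next (step-moves (cong (Maybe.map _)
    (trans (cong (λ s → δ M s _) (Inverse.strictlyInverseʳ (finite M) s)) p))) h

blank : Tape
blank = tape [] ␣ []

-- Room for a second machine: M ignores the tapes inserted behind its first one.
spread : ∀ {A : Set} → A → A → A → Vec A (suc k) → Vec A (4 + k)
spread a b c (x ∷ xs) = x ∷ a ∷ b ∷ c ∷ xs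

fromTM : (M : TM) → Machine (4 + TM.extraTapes M)
fromTM M = record
  { State = Fin (TM.states M) ; size = TM.states M ; finite = ↔-refl ; start = TM.start M
  ; δ = λ { q (x ∷ a ∷ b ∷ c ∷ v) →
      Maybe.map (map₂ (spread (a , stay) (b , stay) (c , stay))) (TM.δ M q (x ∷ v)) } }

fromTM-run : ∀ {M q q′ a b c ts us} → HaltsIn M t (q , ts) (q′ , us) →
             Run (fromTM M) t q (spread a b c ts) (spread a b c us)
fromTM-run {M = M} {q} {a = a} {b} {c} {T ∷ ts} (halt p) with TM.δ M q (scans (T ∷ ts)) in e
... | nothing = done (cong (Maybe.map _) e)
fromTM-run {M = M} {q} {a = a} {b} {c} {T ∷ ts} {us} (next p h) with TM.δ M q (scans (T ∷ ts)) in e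
fromTM-run {M = M} {q} {a = a} {b} {c} {T ∷ ts} {us} (next refl h) | just (r , α ∷ as) =
  go (cong (Maybe.map _) e)
     (subst₂ (λ T′ ts′ → Run (fromTM M) _ r (T′ ∷ a ∷ b ∷ c ∷ ts′) _)
       (act≗act′ α T) (zipWith-act as ts) (fromTM-run h))

written : Tape → List Sym
written (tape _ s rs) = s ∷ rs

push-length : ∀ s cs → List.length (push s cs) ≤ suc (List.length cs)
push-length (just _) cs      = ≤-refl
push-length ␣        []      = z≤n
push-length ␣        (_ ∷ _) = ≤-refl

act-length : ∀ a T → List.length (written (act a T)) ≤ suc (List.length (written T))
act-length (s , left)  (tape []      _ rs)      = s≤s (push-length s rs)
act-length (s , left)  (tape (_ ∷ _) _ rs)      = s≤s (push-length s rs)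
act-length (s , stay)  _                        = n≤1+n _
act-length (s , right) (tape _ _ [])            = s≤s z≤n
act-length (s , right) (tape _ _ (_ ∷ _))       = m≤n⇒m≤1+n (n≤1+n _)

-- Each step brings at most one more cell into the part of the first tape that starts at the head.
-- The output of the first machine, hence the input of the second, is thus polynomially long.
run-length : ∀ {M q q′} {ts us : Vec Tape (TM.tapes M)} → HaltsIn M t (q , ts) (q′ , us) →
             List.length (written (head us)) ≤ t + List.length (written (head ts))
run-length (halt _) = ≤-refl
run-length {M = M} {q} {ts = T ∷ ts} (next p h) with TM.δ M q (scans (T ∷ ts))
run-length {suc t} {M = M} {q} {ts = T ∷ ts} (next refl h) | just (r , α ∷ as) =
  ≤-trans (run-length h)
    (≤-trans (+-monoʳ-≤ t (act-length α T)) (≤-reflexive (+-suc t _)))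

-- `G` is the rubbish behind the output, in the form in which `Computes.runs` takes it.
upToBlank-split : ∀ cs → ∃ λ G → cs ≡ List.map just (upToBlank cs) ++ G × hd G ≡ ␣
upToBlank-split []            = [] , refl , refl
upToBlank-split (␣ ∷ cs)      = ␣ ∷ cs , refl , refl
upToBlank-split (just b ∷ cs) =
  let G , p , q = upToBlank-split cs in G , cong (just b ∷_) p , q

upToBlank-length : ∀ cs → List.length (upToBlank cs) ≤ List.length cs
upToBlank-length []            = z≤n
upToBlank-length (␣ ∷ _)       = z≤n
upToBlank-length (just _ ∷ cs) = s≤s (upToBlank-length cs)

-- Polynomial bounds and composition of polynomial-time functions

-- Only positive arguments are bounded: inputs are nonempty, and at 0 a monomial of positive degree
-- could not absorb a constant.
record Poly (T : ℕ → ℕ) : Set where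
  constructor poly
  field
    factor degree : ℕ
    bound         : ∀ n → T (suc n) ≤ factor * suc n ^ degree

poly-const : ∀ c → Poly (const c)
poly-const c = poly c 0 λ _ → ≤-reflexive (sym (*-identityʳ c))

poly-id : Poly id
poly-id = poly 1 1 λ n → ≤-reflexive (sym (trans (*-identityˡ _) (^-identityʳ (suc n))))

-- The sum of the degrees serves as a common exponent, because the base `suc n` is positive.
poly-+ : ∀ {S T} → Poly S → Poly T → Poly (λ n → S n + T n)
poly-+ {S} {T} (poly c k p) (poly d l q) = poly (c + d) (k + l) λ n → begin
  S (suc n) + T (suc n)                       ≤⟨ +-mono-≤ (p n) (q n) ⟩
  c * suc n ^ k + d * suc n ^ l               ≤⟨ +-mono-≤ (*-monoʳ-≤ c (^-monoʳ-≤ (suc n) (m≤m+n k l)))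
                                                          (*-monoʳ-≤ d (^-monoʳ-≤ (suc n) (m≤n+m l k))) ⟩
  c * suc n ^ (k + l) + d * suc n ^ (k + l)   ≡⟨ *-distribʳ-+ _ c d ⟨
  (c + d) * suc n ^ (k + l)                   ∎
  where open ≤-Reasoning

poly-* : ∀ {S T} → Poly S → Poly T → Poly (λ n → S n * T n)
poly-* {S} {T} (poly c k p) (poly d l q) = poly (c * d) (k + l) λ n → begin
  S (suc n) * T (suc n)              ≤⟨ *-mono-≤ (p n) (q n) ⟩
  c * suc n ^ k * (d * suc n ^ l)    ≡⟨ [m*n]*[o*p]≡[m*o]*[n*p] c (suc n ^ k) d (suc n ^ l) ⟩
  c * d * (suc n ^ k * suc n ^ l)    ≡⟨ cong (c * d *_) (^-distribˡ-+-* (suc n) k l) ⟨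
  c * d * suc n ^ (k + l)            ∎
  where open ≤-Reasoning

poly-suc : ∀ {T} → Poly T → Poly (suc ∘ T)
poly-suc = poly-+ (poly-const 1)

poly-^ : ∀ {T} → Poly T → ∀ k → Poly (λ n → T n ^ k)
poly-^ p zero    = poly-const 1
poly-^ p (suc k) = poly-* p (poly-^ p k)

-- A machine that may take over where another one has stopped: it is given its
-- input between arbitrary rubbish on the first tape.
record Computes (g : Σ⁺ → Σ⁺) : Set₁ where
  field
    machine : Machine 4
    time    : ℕ → ℕ
    isPoly  : Poly time
    runs    : ∀ w L G → hd G ≡ ␣ → ∃ λ us →
              machine ⊢ L ▹ (List.map just (toList w) ++ G) ∷ blank ∷ blank ∷ blank ∷ []
                ⇒⟨ time (length w) ⟩ us
              × upToBlank (written (head us)) ≡ toList (g w)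

-- `M` runs on the first tape and on those from the fifth on, the second machine on the first four,
-- so that its working tapes are still blank when it takes over.
polytime-∘ : ∀ {f g} → PolyTime f → Computes g → PolyTime (g ∘ f)
polytime-∘ {f} {g} (M , c , k , halts) C =
  toTM P , d , l , bounded
  where
  open Computes C
  P : Machine (4 + TM.extraTapes M)
  P = fromTM M ⨾ machine ↑ TM.extraTapes M
  open Poly isPoly
  -- `time` need not be monotone, so its polynomial bound takes its place, evaluated at an upper
  -- bound for the length of `f w`.
  total : ℕ → ℕ
  total n = suc (c * n ^ k + factor * (c * n ^ k + n) ^ degree)
  total-poly : Poly total
  total-poly = poly-suc (poly-+ halting
    (poly-* (poly-const factor) (poly-^ (poly-+ halting poly-id) degree)))
    where
    halting : Poly (λ n → c * n ^ k)
    halting = poly-* (poly-const c) (poly-^ poly-id k)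
  d = Poly.factor total-poly
  l = Poly.degree total-poly
  time-≤ : ∀ {m n} → suc m ≤ n → time (suc m) ≤ factor * n ^ degree
  time-≤ {m} m≤n = ≤-trans (bound m) (*-monoʳ-≤ factor (^-monoˡ-≤ degree m≤n))
  bounded : ∀ w → ∃₂ λ t D → t ≤ d * length w ^ l × HaltsIn (toTM P) t (initial (toTM P) w) D
                           × output (toTM P) D ≡ toList (g (f w))
  bounded w@(b ∷ bs) with halts w
  ... | t , (q , tape L s R ∷ us) , t≤ , h , out
    with G , split , G-blank ← upToBlank-split (s ∷ R)
    with T ∷ vs , r , out′ ← runs (f w) L G G-blank =
    let t′ , q′ , t′≤ , h′ = toTM-halts {M = P} (fromTM-run {M = M} h ⨾-run
          subst (λ T′ → machine ↑ _ ⊢ T′ ∷ blank ∷ blank ∷ blank ∷ us ⇒⟨ _ ⟩ _) (sym eq) (↑-run us r))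
    in t′ , (q′ , T ∷ vs Vec.++ us)
     , ≤-trans t′≤ (≤-trans (s≤s (+-mono-≤ t≤ (time-≤ len))) (Poly.bound total-poly (List.length bs)))
     , h′ , out′
    where
    eq : tape L s R ≡ L ▹ (List.map just (toList (f w)) ++ G)
    eq = cong (L ▹_) (trans split (cong (λ u → List.map just u ++ G) out))
    len : length (f w) ≤ c * length w ^ k + length w
    len = begin
      length (f w)                       ≡⟨ cong List.length out ⟨
      List.length (upToBlank (s ∷ R))    ≤⟨ upToBlank-length (s ∷ R) ⟩
      List.length (s ∷ R)                ≤⟨ run-length h ⟩
      t + suc (List.length (List.map just bs)) ≡⟨ cong (λ n → t + suc n) (List.length-map just bs) ⟩
      t + length w                       ≤⟨ +-monoˡ-≤ (length w) t≤ ⟩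
      c * length w ^ k + length w        ∎
      where open ≤-Reasoning

-- Rewinding, loading the input and delivering the output

⌜_⌝ : List Bool → List Sym
⌜_⌝ = List.map just

∣_∣ : List Bool → ℕ
∣_∣ = List.length

⌜⌝-ʳ++ : ∀ u {cs} → ⌜ u ⌝ ʳ++ cs ≡ ⌜ reverse u ⌝ ++ cs
⌜⌝-ʳ++ u {cs} = begin
  ⌜ u ⌝ ʳ++ cs           ≡⟨ List.ʳ++-defn ⌜ u ⌝ ⟩
  reverse ⌜ u ⌝ ++ cs    ≡⟨ cong (_++ cs) (List.reverse-map just u) ⟨
  ⌜ reverse u ⌝ ++ cs    ∎
  where open ≡-Reasoning

⌜reverse⌝-ʳ++ : ∀ u {cs} → ⌜ reverse u ⌝ ʳ++ cs ≡ ⌜ u ⌝ ++ cs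
⌜reverse⌝-ʳ++ u {cs} = trans (⌜⌝-ʳ++ (reverse u)) (cong (λ v → ⌜ v ⌝ ++ cs) (List.reverse-involutive u))

at : Fin k → Vec Sym k → Bool
at i v = is-just (lookup v i)

moveBy : Move → Machine 1
moveBy d = prim λ v → (lookup v zero , d) ∷ []

-- `g` rewrites the cell where the return starts: `id` leaves it, `const ␣` ends the output,
-- `const (just I)` completes a carry.
rewind : (Sym → Sym) → Machine 1
rewind g = prim (λ v → (g (lookup v zero) , left) ∷ []) ⨾ while (at zero) (moveBy left) ⨾ moveBy right

rewindTime : ℕ → ℕ
rewindTime n = 3 + (n * 3 + 1)

passTime : ℕ → ℕ
passTime n = suc (n * 3 + rewindTime n)

rewindTime-mono : m ≤ n → rewindTime m ≤ rewindTime n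
rewindTime-mono p = +-monoʳ-≤ 3 (+-monoˡ-≤ 1 (*-monoˡ-≤ 3 p))

passTime-mono : m ≤ n → passTime m ≤ passTime n
passTime-mono p = s≤s (+-mono-≤ (*-monoˡ-≤ 3 p) (rewindTime-mono p))

rewind-loop : ∀ v {L R} → hd L ≡ ␣ →
              while (at zero) (moveBy left) ⊢ tape (tl (⌜ v ⌝ ++ L)) (hd (⌜ v ⌝ ++ L)) R ∷ []
                ⇒⟨ ∣ v ∣ * 3 ⟩ tape (tl L) (hd L) (⌜ v ⌝ ʳ++ R) ∷ []
rewind-loop []      p = while-stop (cong is-just p)
rewind-loop (b ∷ v) p = while-go refl (prim-run _) (rewind-loop v p)

-- As `L` starts with a blank or is empty, `push ␣ (tl L)` is the same tape content up to outermost
-- blanks.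
rewind-reversed : ∀ g v {L s R} → hd L ≡ ␣ →
                  rewind g ⊢ tape (⌜ v ⌝ ++ L) s R ∷ []
                    ⇒⟨ rewindTime ∣ v ∣ ⟩ push ␣ (tl L) ▹ (⌜ v ⌝ ʳ++ push (g s) R) ∷ []
rewind-reversed g v {L} {s} {R} p = prim-run _ ⨾-run rewind-loop v p ⨾-run
  subst (λ s′ → moveBy right ⊢ tape (tl L) (hd L) cs ∷ [] ⇒⟨ 1 ⟩ push s′ (tl L) ▹ cs ∷ []) p (prim-run _)
  where cs = ⌜ v ⌝ ʳ++ push (g s) R

rewind-run : ∀ g u {L s R} → hd L ≡ ␣ →
             rewind g ⊢ tape (⌜ u ⌝ ʳ++ L) s R ∷ []
               ⇒⟨ rewindTime ∣ u ∣ ⟩ push ␣ (tl L) ▹ (⌜ u ⌝ ++ push (g s) R) ∷ []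
rewind-run g u {L} {s} {R} p
  rewrite sym (⌜reverse⌝-ʳ++ u {push (g s) R}) | sym (List.length-reverse u) | ⌜⌝-ʳ++ u {L} =
  rewind-reversed g (reverse u) p

rewind-to-start : ∀ u → rewind id ⊢ (⌜ u ⌝ ʳ++ []) ▹ [] ∷ [] ⇒⟨ rewindTime ∣ u ∣ ⟩ [] ▹ ⌜ u ⌝ ∷ []
rewind-to-start u =
  subst (λ cs → rewind id ⊢ (⌜ u ⌝ ʳ++ []) ▹ [] ∷ [] ⇒⟨ rewindTime ∣ u ∣ ⟩ [] ▹ cs ∷ [])
    (List.++-identityʳ ⌜ u ⌝) (rewind-run id u refl)

emit : List Bool → Tape → Tape
emit u T = List.foldl (λ T b → act′ (just b , right) T) T u

emit-++ : ∀ u v T → emit (u ++ v) T ≡ emit v (emit u T)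
emit-++ u v T = List.foldl-++ _ T u v

emit-▹ : ∀ u L G → ∃ λ G′ → emit u (L ▹ G) ≡ (⌜ u ⌝ ʳ++ L) ▹ G′
emit-▹ []      L G = G , refl
emit-▹ (b ∷ u) L G = emit-▹ u (just b ∷ L) (tl G)

write : Bool → Machine 4
write b = prim λ v → idle v [ 0F ]≔ (just b , right)

copy : Machine 4
copy = while (at 0F) (prim λ v → idle v [ 0F ]≔ (lookup v 0F , right) [ 1F ]≔ (lookup v 0F , right))

copy-run : ∀ w {L L′ G T U} → hd G ≡ ␣ →
           copy ⊢ L ▹ (⌜ w ⌝ ++ G) ∷ L′ ▹ [] ∷ T ∷ U ∷ []
             ⇒⟨ ∣ w ∣ * 3 ⟩ (⌜ w ⌝ ʳ++ L) ▹ G ∷ (⌜ w ⌝ ʳ++ L′) ▹ [] ∷ T ∷ U ∷ []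
copy-run []      p = while-stop (cong is-just p)
copy-run (b ∷ w) p = while-go refl (prim-run _) (copy-run w p)

-- The blank written behind the input is where `finish` will stop rewinding, so whatever stands
-- further left stays out of the output.
load : Machine 4
load = copy ⨾ on 0F (prim λ _ → (␣ , right) ∷ []) ⨾ on 1F (rewind id)

load-run : ∀ w L G → hd G ≡ ␣ →
           load ⊢ L ▹ (⌜ w ⌝ ++ G) ∷ blank ∷ blank ∷ blank ∷ []
             ⇒⟨ suc (∣ w ∣ * 3 + suc (1 + rewindTime ∣ w ∣)) ⟩
             push ␣ (⌜ w ⌝ ʳ++ L) ▹ tl G ∷ [] ▹ ⌜ w ⌝ ∷ blank ∷ blank ∷ []
load-run w L G p =
  copy-run w p ⨾-run on-run 0F (prim-run _) refl ⨾-run on-run 1F (rewind-to-start w) refl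

hd-push : ∀ s cs → hd (push s cs) ≡ s
hd-push (just _) cs      = refl
hd-push ␣        []      = refl
hd-push ␣        (_ ∷ _) = refl

upToBlank-written : ∀ u cs → upToBlank (written ([] ▹ (⌜ u ⌝ ++ push ␣ cs))) ≡ u
upToBlank-written []      []       = refl
upToBlank-written []      (_ ∷ _)  = refl
upToBlank-written (b ∷ u) cs       = cong (b ∷_) (upToBlank-++ u cs)
  where
  upToBlank-++ : ∀ u cs → upToBlank (⌜ u ⌝ ++ push ␣ cs) ≡ u
  upToBlank-++ []      []      = refl
  upToBlank-++ []      (_ ∷ _) = refl
  upToBlank-++ (b ∷ u) cs      = cong (b ∷_) (upToBlank-++ u cs)

-- The blank written behind the output cuts it off from rubbish on its right.
finish : Machine 4
finish = on 0F (rewind (const ␣))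

finish-run : ∀ u {L G us} → hd L ≡ ␣ → ∃ λ T →
             finish ⊢ emit u (L ▹ G) ∷ us ⇒⟨ rewindTime ∣ u ∣ ⟩ T ∷ us × upToBlank (written T) ≡ u
finish-run u {L} {G} p with G′ , eq ← emit-▹ u L G rewrite eq =
  _ , on-run 0F (rewind-run _ u p) refl , upToBlank-written u (tl G′)

-- Transducers

-- The phases of reading an encoding.  pre and preD belong to a number that is
-- followed by another one, num and numD to the number just before the formula;
-- a digit comes next in preD and numD.
Phase : Set
Phase = Fin 10

pattern pre   = 0F
pattern preD  = 1F
pattern num   = 2F
pattern numD  = 3F
pattern token = 4F
pattern tokO  = 5F
pattern tokI  = 6F
pattern tokII = 7F
pattern varX  = 8F
pattern varY  = 9F

next-phase : Phase → Bool → Phase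
next-phase pre   O = num
next-phase pre   I = preD
next-phase preD  _ = pre
next-phase num   O = token
next-phase num   I = numD
next-phase numD  _ = num
next-phase token O = tokO
next-phase token I = tokI
next-phase tokO  _ = token
next-phase tokI  O = token
next-phase tokI  I = tokII
next-phase tokII O = varX
next-phase tokII I = varY
next-phase varX  O = token
next-phase varX  I = varX
next-phase varY  O = token
next-phase varY  I = varY

-- What is written when a letter is read: at most one letter, then some 0s.
Response : Set
Response = Phase → Bool → Maybe Bool × Fin 3

module _ (ρ : Response) where

  transduce : Phase → List Bool → List Bool
  transduce q []      = []
  transduce q (b ∷ w) =
    List.fromMaybe (proj₁ (ρ q b)) ++ replicate (toℕ (proj₂ (ρ q b))) O ++ transduce (next-phase q b) w

  feed : Maybe Bool → Vec Sym 4 → Vec (Sym × Move) 4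
  feed c v = maybe (λ b → idle v [ 0F ]≔ (just b , right)) (idle v) c [ 1F ]≔ (lookup v 1F , right)

  -- The second component of a state is the number of 0s still to be written.
  transducer : Phase → Machine 4
  transducer q₀ = record
    { State = Phase × Fin 3 ; size = 30 ; finite = ↔-sym (*↔× {10} {3}) ; start = q₀ , zero
    ; δ = λ { (q , suc p) v → just ((q , inject₁ p) , idle v [ 0F ]≔ (just O , right))
            ; (q , zero)  v → maybe (λ b → just ((next-phase q b , proj₂ (ρ q b)) , feed (proj₁ (ρ q b)) v))
                                    nothing (lookup v 1F) } }

  transducer-run : ∀ {q₀} q p n w {L S T U} → toℕ p ≡ n →
    Run (transducer q₀) (n + ∣ w ∣ * 3) (q , p) (S ∷ L ▹ ⌜ w ⌝ ∷ T ∷ U ∷ [])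
      (emit (replicate n O ++ transduce q w) S ∷ (⌜ w ⌝ ʳ++ L) ▹ [] ∷ T ∷ U ∷ [])
  transducer-run q (suc p) (suc n) w e =
    go refl (transducer-run q (inject₁ p) n w (trans (toℕ-inject₁ p) (suc-injective e)))
  transducer-run q zero zero []      e = done refl
  -- A letter costs its reading step and at most two pending 0s, hence the factor 3.
  transducer-run {q₀} q zero zero (b ∷ w) {L} {S} {T} {U} e = go refl
    (run-mono (+-monoˡ-≤ (∣ w ∣ * 3) (s≤s⁻¹ (toℕ<n (proj₂ (ρ q b))))) (after (proj₁ (ρ q b))))
    where
    p′ = proj₂ (ρ q b)
    w′ = transduce (next-phase q b) w
    after : ∀ c → Run (transducer q₀) (toℕ p′ + ∣ w ∣ * 3) (next-phase q b , p′)
      (zipWith act′ (feed c (scans (S ∷ L ▹ ⌜ b ∷ w ⌝ ∷ T ∷ U ∷ []))) (S ∷ L ▹ ⌜ b ∷ w ⌝ ∷ T ∷ U ∷ []))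
      (emit (List.fromMaybe c ++ replicate (toℕ p′) O ++ w′) S ∷ (⌜ b ∷ w ⌝ ʳ++ L) ▹ [] ∷ T ∷ U ∷ [])
    after (just _) = transducer-run (next-phase q b) p′ (toℕ p′) w refl
    after nothing  = transducer-run (next-phase q b) p′ (toℕ p′) w refl

-- Binary counters, least significant digit first

incr : List Bool → List Bool
incr []       = I ∷ []
incr (O ∷ bs) = I ∷ bs
incr (I ∷ bs) = O ∷ incr bs

incr-length : ∀ bs → ∣ incr bs ∣ ≤ suc ∣ bs ∣
incr-length []       = ≤-refl
incr-length (O ∷ bs) = n≤1+n _
incr-length (I ∷ bs) = s≤s (incr-length bs)

isOne : Vec Sym 1 → Bool
isOne (just b ∷ []) = b
isOne (␣ ∷ [])      = false

carry : Machine 1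
carry = while isOne (prim λ _ → (just O , right) ∷ [])

-- The scanned symbol `s`, a 0 or a blank, is left open since `rewind` replaces it by the 1 that
-- ends the carry.
carry-run : ∀ bs L → ∃ λ u → ∃₂ λ s R →
            ⌜ incr bs ⌝ ≡ ⌜ u ⌝ ++ just I ∷ R × ∣ u ∣ ≤ ∣ bs ∣ ×
            (carry ⊢ L ▹ ⌜ bs ⌝ ∷ [] ⇒⟨ ∣ bs ∣ * 3 ⟩ tape (⌜ u ⌝ ʳ++ L) s R ∷ [])
carry-run []       L = [] , _ , _ , refl , z≤n , while-stop refl
carry-run (O ∷ bs) L = [] , _ , _ , refl , z≤n , while-stop refl
carry-run (I ∷ bs) L with u , s , R , p , q , r ← carry-run bs (just O ∷ L) =
  O ∷ u , s , R , cong (just O ∷_) p , s≤s q , while-go refl (prim-run _) r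

inc : Machine 1
inc = carry ⨾ rewind (const (just I))

inc-run : ∀ bs → inc ⊢ [] ▹ ⌜ bs ⌝ ∷ [] ⇒⟨ passTime ∣ bs ∣ ⟩ [] ▹ ⌜ incr bs ⌝ ∷ []
inc-run bs with u , s , R , p , q , r ← carry-run bs [] rewrite p =
  r ⨾-run run-mono (+-monoʳ-≤ 3 (+-monoˡ-≤ 1 (*-monoˡ-≤ 3 q))) (rewind-run (const (just I)) u refl)

tally : ℕ → List Bool → List Bool
tally zero    bs = bs
tally (suc n) bs = tally n (incr bs)

-- One digit more per increment is crude, but it is linear and so good enough for polynomial time.
tally-length : ∀ n bs → ∣ tally n bs ∣ ≤ ∣ bs ∣ + n
tally-length zero    bs = m≤m+n _ 0
tally-length (suc n) bs = begin
  ∣ tally n (incr bs) ∣    ≤⟨ tally-length n (incr bs) ⟩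
  ∣ incr bs ∣ + n          ≤⟨ +-monoˡ-≤ n (incr-length bs) ⟩
  suc ∣ bs ∣ + n           ≡⟨ +-suc ∣ bs ∣ n ⟨
  ∣ bs ∣ + suc n           ∎
  where open ≤-Reasoning

ones : ℕ → List Bool
ones n = replicate n I

-- The length of the input is produced twice: in binary on the third tape for the numbers of the
-- encoding, in unary on the fourth for the variable indices. The unary count is written leftwards,
-- so that a single move afterwards reaches its first 1.
count : Machine 4
count = while (at 1F)
  (prim (λ v → idle v [ 1F ]≔ (lookup v 1F , right) [ 3F ]≔ (just I , left)) ⨾ on 2F inc)

countTime : ℕ → ℕ
countTime n = 3 + suc (passTime n)

count-run : ∀ w bs i {N n L T} → ∣ bs ∣ + ∣ w ∣ ≤ N → ∣ w ∣ + i ≡ n →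
            count ⊢ T ∷ L ▹ ⌜ w ⌝ ∷ [] ▹ ⌜ bs ⌝ ∷ tape [] ␣ ⌜ ones i ⌝ ∷ []
              ⇒⟨ ∣ w ∣ * countTime N ⟩
              T ∷ (⌜ w ⌝ ʳ++ L) ▹ [] ∷ [] ▹ ⌜ tally ∣ w ∣ bs ⌝ ∷ tape [] ␣ ⌜ ones n ⌝ ∷ []
count-run []      bs i p refl = while-stop refl
count-run (b ∷ w) bs i {N} p q =
  while-go refl
    (prim-run _ ⨾-run on-run 2F (run-mono (passTime-mono (≤-trans (m≤m+n ∣ bs ∣ _) p)) (inc-run bs)) refl)
    (count-run w (incr bs) (suc i)
      (≤-trans (≤-trans (+-monoˡ-≤ ∣ w ∣ (incr-length bs)) (≤-reflexive (sym (+-suc ∣ bs ∣ ∣ w ∣)))) p)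
      (trans (+-suc ∣ w ∣ i) q))

pairs : List Bool → List Bool
pairs = List.concatMap λ b → I ∷ b ∷ []

digits : Machine 4
digits = while (at 2F)
  (write I ⨾ prim λ v → idle v [ 0F ]≔ (lookup v 2F , right) [ 2F ]≔ (lookup v 2F , left))

digits-run : ∀ v {R S T U} →
             digits ⊢ S ∷ T ∷ tape (tl (⌜ v ⌝ ++ [])) (hd (⌜ v ⌝ ++ [])) R ∷ U ∷ []
               ⇒⟨ ∣ v ∣ * 5 ⟩ emit (pairs v) S ∷ T ∷ tape [] ␣ (⌜ v ⌝ ʳ++ R) ∷ U ∷ []
digits-run []      = while-stop refl
digits-run (b ∷ v) = while-go refl (prim-run _ ⨾-run prim-run _) (digits-run v)

toEnd : Machine 1
toEnd = while (at 0F) (moveBy right)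

toEnd-run : ∀ w {L} → toEnd ⊢ L ▹ ⌜ w ⌝ ∷ [] ⇒⟨ ∣ w ∣ * 3 ⟩ (⌜ w ⌝ ʳ++ L) ▹ [] ∷ []
toEnd-run []      = while-stop refl
toEnd-run (b ∷ w) = while-go refl (prim-run _) (toEnd-run w)

encoding : List Bool → List Bool
encoding bs = pairs (reverse bs) ++ O ∷ []

-- The counter has its least significant digit first and is therefore read from its far end; reading
-- leftwards also brings the head back, ready for a second copy.
writeNumber : Machine 4
writeNumber = on 2F (toEnd ⨾ moveBy left) ⨾ digits ⨾ on 2F (moveBy right) ⨾ write O

writeNumberTime : ℕ → ℕ
writeNumberTime n = 2 + (n * 3 + 1) + suc (n * 5 + 3)

writeNumber-run : ∀ bs {S T U} →
                  writeNumber ⊢ S ∷ T ∷ [] ▹ ⌜ bs ⌝ ∷ U ∷ []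
                    ⇒⟨ writeNumberTime ∣ bs ∣ ⟩ emit (encoding bs) S ∷ T ∷ [] ▹ ⌜ bs ⌝ ∷ U ∷ []
writeNumber-run bs {S} {T} {U} rewrite emit-++ (pairs (reverse bs)) (O ∷ []) S =
  on-run 2F (toEnd-run bs ⨾-run prim-run _) refl ⨾-run
  subst₂ (λ cs n → digits ⊢ S ∷ T ∷ tape (tl cs) (hd cs) [] ∷ U ∷ [] ⇒⟨ n * 5 ⟩
             emit (pairs (reverse bs)) S ∷ T ∷ tape [] ␣ (⌜ reverse bs ⌝ ʳ++ []) ∷ U ∷ [])
    (sym (⌜⌝-ʳ++ bs)) (List.length-reverse bs) (digits-run (reverse bs)) ⨾-run
  on-run 2F back refl ⨾-run prim-run _
  where
  back : moveBy right ⊢ tape [] ␣ (⌜ reverse bs ⌝ ʳ++ []) ∷ [] ⇒⟨ 1 ⟩ [] ▹ ⌜ bs ⌝ ∷ []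
  back = subst (λ cs → moveBy right ⊢ tape [] ␣ (⌜ reverse bs ⌝ ʳ++ []) ∷ [] ⇒⟨ 1 ⟩ [] ▹ cs ∷ [])
           (trans (⌜reverse⌝-ʳ++ bs) (List.++-identityʳ ⌜ bs ⌝)) (prim-run _)

-- Templates: strings with places (nothing) for the unary number on the last tape

render : ℕ → List (Maybe Bool) → List Bool
render i = List.concatMap (maybe (_∷ []) (ones i))

writeOnes : Machine 4
writeOnes =
  while (at 3F) (prim λ v → idle v [ 0F ]≔ (just I , right) [ 3F ]≔ (lookup v 3F , right)) ⨾
  on 3F (rewind id)

ones-loop : ∀ i {L S T U} →
  while (at 3F) (prim λ v → idle v [ 0F ]≔ (just I , right) [ 3F ]≔ (lookup v 3F , right))
    ⊢ S ∷ T ∷ U ∷ L ▹ ⌜ ones i ⌝ ∷ [] ⇒⟨ i * 3 ⟩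
      emit (ones i) S ∷ T ∷ U ∷ (⌜ ones i ⌝ ʳ++ L) ▹ [] ∷ []
ones-loop zero    = while-stop refl
ones-loop (suc i) = while-go refl (prim-run _) (ones-loop i)

writeOnes-run : ∀ i {S T U} →
  writeOnes ⊢ S ∷ T ∷ U ∷ [] ▹ ⌜ ones i ⌝ ∷ [] ⇒⟨ passTime i ⟩
    emit (ones i) S ∷ T ∷ U ∷ [] ▹ ⌜ ones i ⌝ ∷ []
writeOnes-run i = ones-loop i ⨾-run on-run 3F back refl
  where
  back : rewind id ⊢ (⌜ ones i ⌝ ʳ++ []) ▹ [] ∷ [] ⇒⟨ rewindTime i ⟩ [] ▹ ⌜ ones i ⌝ ∷ []
  back = subst (λ n → rewind id ⊢ (⌜ ones i ⌝ ʳ++ []) ▹ [] ∷ [] ⇒⟨ rewindTime n ⟩ [] ▹ ⌜ ones i ⌝ ∷ [])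
           (List.length-replicate i) (rewind-to-start (ones i))

fill : List (Maybe Bool) → Machine 4
fill []             = skip
fill (just b ∷ ps)  = write b ⨾ fill ps
fill (nothing ∷ ps) = writeOnes ⨾ fill ps

fillTime : List (Maybe Bool) → ℕ → ℕ
fillTime []             i = 0
fillTime (just _ ∷ ps)  i = suc (1 + fillTime ps i)
fillTime (nothing ∷ ps) i = suc (passTime i + fillTime ps i)

fill-run : ∀ ps i {S T U} →
  fill ps ⊢ S ∷ T ∷ U ∷ [] ▹ ⌜ ones i ⌝ ∷ [] ⇒⟨ fillTime ps i ⟩
    emit (render i ps) S ∷ T ∷ U ∷ [] ▹ ⌜ ones i ⌝ ∷ []
fill-run []             i = done refl
fill-run (just b ∷ ps)  i = prim-run _ ⨾-run fill-run ps i
fill-run (nothing ∷ ps) i {S} rewrite emit-++ (ones i) (render i ps) S =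
  writeOnes-run i ⨾-run fill-run ps i

fillTime-mono : ∀ ps → m ≤ n → fillTime ps m ≤ fillTime ps n
fillTime-mono []             p = z≤n
fillTime-mono (just _ ∷ ps)  p = s≤s (s≤s (fillTime-mono ps p))
fillTime-mono (nothing ∷ ps) p = s≤s (+-mono-≤ (passTime-mono p) (fillTime-mono ps p))

renderAll : List (Maybe Bool) → ℕ → List Bool
renderAll ps zero    = []
renderAll ps (suc i) = render i ps ++ renderAll ps i

-- Erasing a 1 before each round makes the index run from one below the initial count down to 0.
fillAll : List (Maybe Bool) → Machine 4
fillAll ps = while (at 3F) (prim (λ v → idle v [ 3F ]≔ (␣ , right)) ⨾ fill ps)

fillAll-run : ∀ ps i {N S T U} → i ≤ N →
  fillAll ps ⊢ S ∷ T ∷ U ∷ [] ▹ ⌜ ones i ⌝ ∷ [] ⇒⟨ i * (4 + fillTime ps N) ⟩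
    emit (renderAll ps i) S ∷ T ∷ U ∷ blank ∷ []
fillAll-run ps zero    p = while-stop refl
fillAll-run ps (suc i) {S = S} p rewrite emit-++ (render i ps) (renderAll ps i) S =
  while-go refl (prim-run _ ⨾-run run-mono (fillTime-mono ps (<⇒≤ p)) (fill-run ps i))
    (fillAll-run ps i (<⇒≤ p))

-- From appending machines to polynomial-time functions

act′-before : ∀ a T → List.length (Tape.before (act′ a T)) ≤ suc (List.length (Tape.before T))
act′-before (s , left)  (tape []       _ rs) = z≤n
act′-before (s , left)  (tape (_ ∷ ls) _ rs) = m≤n⇒m≤1+n (n≤1+n _)
act′-before (s , stay)  (tape ls       _ rs) = n≤1+n _
act′-before (s , right) (tape ls       _ rs) = push-length s ls

run-before : ∀ {M : Machine (suc k)} {s} → Run M t s ts us →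
             List.length (Tape.before (head us)) ≤ t + List.length (Tape.before (head ts))
run-before {t = t} (done _) = m≤n+m _ t
run-before {t = suc t} {ts = T ∷ ts} (go {as = a ∷ as} _ r) =
  ≤-trans (run-before r) (≤-trans (+-monoʳ-≤ t (act′-before a T)) (≤-reflexive (+-suc t _)))

record Appends (h : List Bool → List Bool) : Set₁ where
  field
    machine : Machine 4
    time    : ℕ → ℕ
    isPoly  : Poly time
    runs    : ∀ w T → ∃ λ us →
              machine ⊢ T ∷ [] ▹ ⌜ w ⌝ ∷ blank ∷ blank ∷ [] ⇒⟨ time ∣ w ∣ ⟩ emit (h w) T ∷ us

  -- A step adds at most one cell to the left of the head, so the time bounds the output. `computes`
  -- uses this to bound the last rewinding.
  output-length : ∀ w → ∣ h w ∣ ≤ time ∣ w ∣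
  output-length w with us , r ← runs w blank with G , eq ← emit-▹ (h w) [] [] = begin
    ∣ h w ∣                                      ≡⟨ trans (+-identityʳ _) (List.length-map just (h w)) ⟨
    List.length ⌜ h w ⌝ + 0                      ≡⟨ List.length-ʳ++ ⌜ h w ⌝ ⟨
    List.length (⌜ h w ⌝ ʳ++ [])                 ≡⟨ cong (List.length ∘ Tape.before) eq ⟨
    List.length (Tape.before (emit (h w) blank)) ≤⟨ run-before r ⟩
    time ∣ w ∣ + 0                               ≡⟨ +-identityʳ _ ⟩
    time ∣ w ∣                                   ∎
    where open ≤-Reasoning

poly-rewind : ∀ {T} → Poly T → Poly (rewindTime ∘ T)
poly-rewind p = poly-+ (poly-const 3) (poly-+ (poly-* p (poly-const 3)) (poly-const 1))

computes : ∀ {h} g → (∀ w → toList (g w) ≡ h (toList w)) → Appends h → Computes g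
computes {h} g g≡h A = record
  { machine = load ⨾ machine ⨾ finish
  ; time    = λ n → suc (suc (n * 3 + suc (1 + rewindTime n)) + suc (time n + rewindTime (time n)))
  ; isPoly  = poly-suc (poly-+
      (poly-suc (poly-+ (poly-* poly-id (poly-const 3)) (poly-suc (poly-suc (poly-rewind poly-id)))))
      (poly-suc (poly-+ isPoly (poly-rewind isPoly))))
  ; runs    = runs′ }
  where
  open Appends A
  runs′ : ∀ w L G → hd G ≡ ␣ → ∃ λ us → _ ⊢ _ ⇒⟨ _ ⟩ us × upToBlank (written (head us)) ≡ toList (g w)
  runs′ w L G p
    with us , r ← runs (toList w) (push ␣ (⌜ toList w ⌝ ʳ++ L) ▹ tl G)
    with T , r′ , q ← finish-run (h (toList w)) {G = tl G} {us} (hd-push ␣ (⌜ toList w ⌝ ʳ++ L)) =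
    T ∷ us
    , load-run (toList w) L G p ⨾-run r ⨾-run run-mono (rewindTime-mono (output-length (toList w))) r′
    , trans q (sym (g≡h w))

-- The machines of the two reductions

negating : Response
negating varX O = just O , 2F
negating _    b = just b , 0F

keeping : Response
keeping num  _ = nothing , 0F
keeping numD _ = nothing , 0F
keeping _    b = just b , 0F

-- The letter read at `tokII` is the sort of a variable; 1 stands for y.
x↦y : Response
x↦y num   _ = nothing , 0F
x↦y numD  _ = nothing , 0F
x↦y tokII _ = just I , 0F
x↦y _     b = just b , 0F

transducer-appends : ∀ ρ q → Appends (transduce ρ q)
transducer-appends ρ q = record
  { machine = transducer ρ q
  ; time    = _* 3
  ; isPoly  = poly-* poly-id (poly-const 3)
  ; runs    = λ w T → _ , transducer-run ρ q 0F 0 w refl }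

emit-concat : ∀ us T → emit (List.concat us) T ≡ List.foldl (λ T u → emit u T) T us
emit-concat []       T = refl
emit-concat (u ∷ us) T = trans (emit-++ u (List.concat us) T) (emit-concat us (emit u T))

render-just : ∀ i v → render i ⌜ v ⌝ ≡ v
render-just i []      = refl
render-just i (b ∷ v) = cong (b ∷_) (render-just i v)

fill-just-run : ∀ v i {S T U} → 
  fill (List.map just v) ⊢ S ∷ T ∷ U ∷ [] ▹ ⌜ ones i ⌝ ∷ [] ⇒⟨ fillTime (List.map just v) i ⟩
    emit v S ∷ T ∷ U ∷ [] ▹ ⌜ ones i ⌝ ∷ []
fill-just-run v i {S} {T} {U} =
  subst (λ w → fill ⌜ v ⌝ ⊢ S ∷ T ∷ U ∷ [] ▹ ⌜ ones i ⌝ ∷ [] ⇒⟨ fillTime ⌜ v ⌝ i ⟩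
                 emit w S ∷ T ∷ U ∷ [] ▹ ⌜ ones i ⌝ ∷ [])
    (render-just i v) (fill-run ⌜ v ⌝ i)

poly-pass : Poly passTime
poly-pass = poly-suc (poly-+ (poly-* poly-id (poly-const 3)) (poly-rewind poly-id))

poly-fill : ∀ ps → Poly (fillTime ps)
poly-fill []             = poly-const 0
poly-fill (just _ ∷ ps)  = poly-suc (poly-suc (poly-fill ps))
poly-fill (nothing ∷ ps) = poly-suc (poly-+ poly-pass (poly-fill ps))

poly-writeNumber : Poly writeNumberTime
poly-writeNumber =
  poly-+ (poly-+ (poly-const 2) (poly-+ (poly-* poly-id (poly-const 3)) (poly-const 1)))
         (poly-suc (poly-+ (poly-* poly-id (poly-const 5)) (poly-const 3)))


writeNumberTime-mono : m ≤ n → writeNumberTime m ≤ writeNumberTime n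
writeNumberTime-mono p =
  +-mono-≤ (+-monoʳ-≤ 2 (+-monoˡ-≤ 1 (*-monoˡ-≤ 3 p))) (s≤s (+-monoˡ-≤ 3 (*-monoˡ-≤ 5 p)))
writeTally-run : ∀ w {S T U} →
  writeNumber ⊢ S ∷ T ∷ [] ▹ ⌜ tally ∣ w ∣ [] ⌝ ∷ U ∷ [] ⇒⟨ writeNumberTime ∣ w ∣ ⟩
    emit (encoding (tally ∣ w ∣ [])) S ∷ T ∷ [] ▹ ⌜ tally ∣ w ∣ [] ⌝ ∷ U ∷ []
writeTally-run w = run-mono (writeNumberTime-mono (tally-length ∣ w ∣ [])) (writeNumber-run (tally ∣ w ∣ []))


poly-triple : Poly (_* 3)
poly-triple = poly-* poly-id (poly-const 3)

measure : Machine 4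
measure = count ⨾ on 1F (rewind id) ⨾ on 3F (moveBy right)

measureTime : ℕ → ℕ
measureTime n = suc (n * countTime n + suc (rewindTime n + 1))

measure-run : ∀ w {T} →
  measure ⊢ T ∷ [] ▹ ⌜ w ⌝ ∷ blank ∷ blank ∷ [] ⇒⟨ measureTime ∣ w ∣ ⟩
    T ∷ [] ▹ ⌜ w ⌝ ∷ [] ▹ ⌜ tally ∣ w ∣ [] ⌝ ∷ [] ▹ ⌜ ones ∣ w ∣ ⌝ ∷ []
measure-run w =
  count-run w [] 0 ≤-refl (+-identityʳ _) ⨾-run on-run 1F (rewind-to-start w) refl ⨾-run
  on-run 3F (prim-run _) refl

poly-measure : Poly measureTime
poly-measure = poly-suc (poly-+ (poly-* poly-id (poly-+ (poly-const 3) (poly-suc poly-pass)))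
  (poly-suc (poly-+ (poly-rewind poly-id) (poly-const 1))))

bothTransducers : Machine 4
bothTransducers = transducer keeping num ⨾ on 1F (rewind id) ⨾ transducer x↦y num

bothTransducersTime : ℕ → ℕ
bothTransducersTime n = suc (n * 3 + suc (rewindTime n + n * 3))

bothTransducers-run : ∀ w {S T U} →
  bothTransducers ⊢ S ∷ [] ▹ ⌜ w ⌝ ∷ T ∷ U ∷ [] ⇒⟨ bothTransducersTime ∣ w ∣ ⟩
    emit (transduce x↦y num w) (emit (transduce keeping num w) S) ∷ (⌜ w ⌝ ʳ++ []) ▹ [] ∷ T ∷ U ∷ []
bothTransducers-run w =
  transducer-run keeping num 0F 0 w refl ⨾-run on-run 1F (rewind-to-start w) refl ⨾-run
  transducer-run x↦y num 0F 0 w refl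

poly-bothTransducers : Poly bothTransducersTime
poly-bothTransducers = poly-suc (poly-+ poly-triple (poly-suc (poly-+ (poly-rewind poly-id) poly-triple)))

writeTwice : Machine 4
writeTwice = writeNumber ⨾ writeNumber

writeTwiceTime : ℕ → ℕ
writeTwiceTime n = suc (writeNumberTime n + writeNumberTime n)

writeTwice-run : ∀ w {S T U} (let number = encoding (tally ∣ w ∣ [])) →
  writeTwice ⊢ S ∷ T ∷ [] ▹ ⌜ tally ∣ w ∣ [] ⌝ ∷ U ∷ [] ⇒⟨ writeTwiceTime ∣ w ∣ ⟩
    emit number (emit number S) ∷ T ∷ [] ▹ ⌜ tally ∣ w ∣ [] ⌝ ∷ U ∷ []
writeTwice-run w = writeTally-run w ⨾-run writeTally-run w

poly-writeTwice : Poly writeTwiceTime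
poly-writeTwice = poly-suc (poly-+ poly-writeNumber poly-writeNumber)

module Comparer (u : List Bool) (ps : List (Maybe Bool)) (v : List Bool) where

  surround : Machine 4
  surround = fill ⌜ u ⌝ ⨾ fillAll ps ⨾ fill ⌜ v ⌝

  surroundTime : ℕ → ℕ
  surroundTime n = suc (fillTime ⌜ u ⌝ n + suc (n * (4 + fillTime ps n) + fillTime ⌜ v ⌝ 0))

  surround-run : ∀ n {S T U} →
    surround ⊢ S ∷ T ∷ U ∷ [] ▹ ⌜ ones n ⌝ ∷ [] ⇒⟨ surroundTime n ⟩
      emit v (emit (renderAll ps n) (emit u S)) ∷ T ∷ U ∷ blank ∷ []
  surround-run n = fill-just-run u n ⨾-run fillAll-run ps n ≤-refl ⨾-run fill-just-run v 0

  poly-surround : Poly surroundTime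
  poly-surround = poly-suc (poly-+ (poly-fill ⌜ u ⌝)
    (poly-suc (poly-+ (poly-* poly-id (poly-+ (poly-const 4) (poly-fill ps))) (poly-const (fillTime ⌜ v ⌝ 0)))))

  -- The digit 0 in front makes the string visibly nonempty.
  parts : List Bool → List (List Bool)
  parts w =
    (I ∷ O ∷ []) ∷ encoding (tally ∣ w ∣ []) ∷ encoding (tally ∣ w ∣ []) ∷
    transduce keeping num w ∷ transduce x↦y num w ∷
    u ∷ renderAll ps ∣ w ∣ ∷ v ∷ []

  comparer : Machine 4
  comparer = (fill ⌜ I ∷ O ∷ [] ⌝ ⨾ measure) ⨾ writeTwice ⨾ bothTransducers ⨾ surround

  comparerTime : ℕ → ℕ
  comparerTime n =
    suc (suc (4 + measureTime n) + suc (writeTwiceTime n + suc (bothTransducersTime n + surroundTime n)))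

  comparer-poly : Poly comparerTime
  comparer-poly =
    poly-suc (poly-+ (poly-suc (poly-+ (poly-const 4) poly-measure)) (poly-suc (poly-+ poly-writeTwice
    (poly-suc (poly-+ poly-bothTransducers poly-surround)))))

  comparer-run : ∀ w T → comparer ⊢ T ∷ [] ▹ ⌜ w ⌝ ∷ blank ∷ blank ∷ [] ⇒⟨ comparerTime ∣ w ∣ ⟩
    List.foldl (λ T u → emit u T) T (parts w) ∷ (⌜ w ⌝ ʳ++ []) ▹ [] ∷ [] ▹ ⌜ tally ∣ w ∣ [] ⌝ ∷ blank ∷ []
  comparer-run w T =
    (fill-just-run (I ∷ O ∷ []) 0 ⨾-run measure-run w) ⨾-run writeTwice-run w ⨾-run
    bothTransducers-run w ⨾-run surround-run ∣ w ∣

  comparer-appends : Appends (List.concat ∘ parts)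
  comparer-appends = record
    { machine = comparer
    ; time    = comparerTime
    ; isPoly  = comparer-poly
    ; runs    = λ w T →
        (⌜ w ⌝ ʳ++ []) ▹ [] ∷ [] ▹ ⌜ tally ∣ w ∣ [] ⌝ ∷ blank ∷ [] ,
        subst (λ U → comparer ⊢ T ∷ [] ▹ ⌜ w ⌝ ∷ blank ∷ blank ∷ [] ⇒⟨ comparerTime ∣ w ∣ ⟩
                       U ∷ (⌜ w ⌝ ʳ++ []) ▹ [] ∷ [] ▹ ⌜ tally ∣ w ∣ [] ⌝ ∷ blank ∷ [])
          (sym (emit-concat (parts w) T)) (comparer-run w T) }

-- Encodings

-- What the parser has read when its stack is `s`; the top of the stack was read last.
codes : List (Formula m n) → List Bool
codes []      = []
codes (φ ∷ s) = codes s ++ code φ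

ones-++ : ∀ i w → ones i ++ I ∷ w ≡ I ∷ ones i ++ w
ones-++ zero    w = refl
ones-++ (suc i) w = cong (I ∷_) (ones-++ i w)

module _ (s : List (Formula m n)) where

  binary-assoc : ∀ u v c w → ((codes s ++ u) ++ v) ++ c ++ w ≡ (codes s ++ u ++ v ++ c) ++ w
  binary-assoc =
    solve 5 (λ a u v c w → ((a ⊕ u) ⊕ v) ⊕ (c ⊕ w) ⊜ (a ⊕ (u ⊕ (v ⊕ c))) ⊕ w) refl (codes s)

  variable-assoc : ∀ u i w → codes s ++ u ++ ones i ++ O ∷ w ≡ (codes s ++ u ++ ones i ++ O ∷ []) ++ w
  variable-assoc u i =
    solve 5 (λ a u v c w → a ⊕ (u ⊕ (v ⊕ (c ⊕ w))) ⊜ (a ⊕ (u ⊕ (v ⊕ c))) ⊕ w) refl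
      (codes s) u (ones i) (O ∷ [])

-- Converse of `parse-code`: no step of the parser changes `codes s ++ w`. Every string that decodes
-- is thus the code of its formula, so the transducers have to be understood on codes only.
parse-sound  : ∀ w (s : List (Formula m n)) {φ} → parse w s ≡ just φ → codes s ++ w ≡ code φ
parseX-sound : ∀ w i (s : List (Formula m n)) {φ} → parseX w i s ≡ just φ →
               codes s ++ I ∷ I ∷ O ∷ ones i ++ w ≡ code φ
parseY-sound : ∀ w i (s : List (Formula m n)) {φ} → parseY w i s ≡ just φ →
               codes s ++ I ∷ I ∷ I ∷ ones i ++ w ≡ code φ

parse-sound []              (φ ∷ [])    refl = List.++-identityʳ _
parse-sound (O ∷ O ∷ w)     (φ ∷ s)     p =
  trans (solve 4 (λ a b c d → (a ⊕ b) ⊕ (c ⊕ d) ⊜ (a ⊕ (b ⊕ c)) ⊕ d) refl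
          (codes s) (code φ) (O ∷ O ∷ []) w)
        (parse-sound w (~ φ ∷ s) p)
parse-sound (O ∷ I ∷ w)     (ψ ∷ φ ∷ s) p =
  trans (binary-assoc s (code φ) (code ψ) (O ∷ I ∷ []) w) (parse-sound w (φ ∧′ ψ ∷ s) p)
parse-sound (I ∷ O ∷ w)     (ψ ∷ φ ∷ s) p =
  trans (binary-assoc s (code φ) (code ψ) (I ∷ O ∷ []) w) (parse-sound w (φ ∨′ ψ ∷ s) p)
parse-sound (I ∷ I ∷ O ∷ w) s           p = parseX-sound w 0 s p
parse-sound (I ∷ I ∷ I ∷ w) s           p = parseY-sound w 0 s p

parseX-sound (I ∷ w) i s p =
  trans (cong (λ v → codes s ++ I ∷ I ∷ O ∷ v) (ones-++ i w)) (parseX-sound w (suc i) s p)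
parseX-sound {m = m} (O ∷ w) i s p with i <? m
... | yes i<m = trans (trans (cong (λ k → codes s ++ I ∷ I ∷ O ∷ ones k ++ O ∷ w) (sym (toℕ-fromℕ< i<m)))
                          (variable-assoc s (I ∷ I ∷ O ∷ []) (toℕ (fromℕ< i<m)) w))
                   (parse-sound w (x⟨ fromℕ< i<m ⟩ ∷ s) p)

parseY-sound (I ∷ w) j s p =
  trans (cong (λ v → codes s ++ I ∷ I ∷ I ∷ v) (ones-++ j w)) (parseY-sound w (suc j) s p)
parseY-sound {n = n} (O ∷ w) j s p with j <? n
... | yes j<n = trans (trans (cong (λ k → codes s ++ I ∷ I ∷ I ∷ ones k ++ O ∷ w) (sym (toℕ-fromℕ< j<n)))
                          (variable-assoc s (I ∷ I ∷ I ∷ []) (toℕ (fromℕ< j<n)) w))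
                   (parse-sound w (y⟨ fromℕ< j<n ⟩ ∷ s) p)

number-length : ∀ n w {k v} → number n w ≡ just (k , v) → ∣ v ∣ ≤ ∣ w ∣
number-length n (I ∷ O ∷ w) p    = m≤n⇒m≤1+n (m≤n⇒m≤1+n (number-length _ w p))
number-length n (I ∷ I ∷ w) p    = m≤n⇒m≤1+n (m≤n⇒m≤1+n (number-length _ w p))
number-length n (O ∷ w)     refl = n≤1+n _

digit : ℕ → Bool → ℕ
digit n O = 2 * n
digit n I = 1 + 2 * n

value : List Bool → ℕ
value = List.foldr (λ b n → digit n b) 0

value-incr : ∀ bs → value (incr bs) ≡ suc (value bs)
value-incr []       = refl
value-incr (O ∷ bs) = refl
value-incr (I ∷ bs) = trans (cong (2 *_) (value-incr bs)) (*-suc 2 (value bs))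

value-tally : ∀ n bs → value (tally n bs) ≡ n + value bs
value-tally zero    bs = refl
value-tally (suc n) bs =
  trans (value-tally n (incr bs)) (trans (cong (n +_) (value-incr bs)) (+-suc n (value bs)))

number-pairs : ∀ v n w → number n (pairs v ++ w) ≡ number (List.foldl digit n v) w
number-pairs []      n w = refl
number-pairs (O ∷ v) n w = number-pairs v _ w
number-pairs (I ∷ v) n w = number-pairs v _ w

-- `number` evaluates by Horner's rule from the most significant digit; on the reversed counter this
-- left fold is the right fold `value`.
number-encoding : ∀ n w → number 0 (encoding (tally n []) ++ w) ≡ just (n , w)
number-encoding n w
  rewrite List.++-assoc (pairs (reverse (tally n []))) (O ∷ []) w
        | number-pairs (reverse (tally n [])) 0 (O ∷ w)
        | List.reverse-foldl digit 0 (tally n [])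
        | value-tally n [] | +-identityʳ n = refl

-- Substitution

AllX : (Fin m → Set) → Formula m n → Set
AllX P x⟨ i ⟩   = P i
AllX P y⟨ j ⟩   = ⊤
AllX P (~ φ)    = AllX P φ
AllX P (φ ∧′ ψ) = AllX P φ × AllX P ψ
AllX P (φ ∨′ ψ) = AllX P φ × AllX P ψ

AllX-map : ∀ {P Q : Fin m → Set} → (∀ i → P i → Q i) →
           ∀ (φ : Formula m n) → AllX P φ → AllX Q φ
AllX-map f x⟨ i ⟩   p       = f i p
AllX-map f y⟨ j ⟩   p       = p
AllX-map f (~ φ)    p       = AllX-map f φ p
AllX-map f (φ ∧′ ψ) (p , q) = AllX-map f φ p , AllX-map f ψ q
AllX-map f (φ ∨′ ψ) (p , q) = AllX-map f φ p , AllX-map f ψ q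

AllX-universal : ∀ {P : Fin m → Set} → (∀ i → P i) → ∀ (φ : Formula m n) → AllX P φ
AllX-universal f x⟨ i ⟩   = f i
AllX-universal f y⟨ j ⟩   = tt
AllX-universal f (~ φ)    = AllX-universal f φ
AllX-universal f (φ ∧′ ψ) = AllX-universal f φ , AllX-universal f ψ
AllX-universal f (φ ∨′ ψ) = AllX-universal f φ , AllX-universal f ψ

-- Indices are written in unary, so the code of a variable is longer than its index.
AllX-bounded : ∀ (φ : Formula m n) {k} → ∣ code φ ∣ ≤ k → AllX (λ i → toℕ i < k) φ
AllX-bounded x⟨ i ⟩   p = ≤-trans (s≤s (≤-trans i≤ (m≤n+m _ 2))) p
  where
  i≤ : toℕ i ≤ ∣ ones (toℕ i) ++ O ∷ [] ∣
  i≤ = begin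
    toℕ i                              ≡⟨ List.length-replicate (toℕ i) ⟨
    ∣ ones (toℕ i) ∣                   ≤⟨ m≤m+n _ 1 ⟩
    ∣ ones (toℕ i) ∣ + 1               ≡⟨ List.length-++ (ones (toℕ i)) ⟨
    ∣ ones (toℕ i) ++ O ∷ [] ∣         ∎
    where open ≤-Reasoning
AllX-bounded y⟨ j ⟩   p = tt
AllX-bounded (~ φ)    p = AllX-bounded φ (≤-trans (List.length-++-≤ˡ (code φ)) p)
AllX-bounded (φ ∧′ ψ) p =
  AllX-bounded φ (≤-trans (List.length-++-≤ˡ (code φ)) p) ,
  AllX-bounded ψ (≤-trans (≤-trans (List.length-++-≤ˡ (code ψ)) (List.length-++-≤ʳ _ {code φ})) p)
AllX-bounded (φ ∨′ ψ) p =
  AllX-bounded φ (≤-trans (List.length-++-≤ˡ (code φ)) p) ,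
  AllX-bounded ψ (≤-trans (≤-trans (List.length-++-≤ˡ (code ψ)) (List.length-++-≤ʳ _ {code φ})) p)

module _ (σ : Fin m → Formula m′ n′) (τ : Fin n → Formula m′ n′) where

  substitute : Formula m n → Formula m′ n′
  substitute x⟨ i ⟩   = σ i
  substitute y⟨ j ⟩   = τ j
  substitute (~ φ)    = ~ substitute φ
  substitute (φ ∧′ ψ) = substitute φ ∧′ substitute ψ
  substitute (φ ∨′ ψ) = substitute φ ∨′ substitute ψ

  eval-subst : ∀ φ x y → eval (substitute φ) x y ≡
               eval φ (tabulate λ i → eval (σ i) x y) (tabulate λ j → eval (τ j) x y)
  eval-subst x⟨ i ⟩   x y = sym (Vec.lookup∘tabulate _ i)
  eval-subst y⟨ j ⟩   x y = sym (Vec.lookup∘tabulate _ j)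
  eval-subst (~ φ)    x y = cong not (eval-subst φ x y)
  eval-subst (φ ∧′ ψ) x y = cong₂ _∧_ (eval-subst φ x y) (eval-subst ψ x y)
  eval-subst (φ ∨′ ψ) x y = cong₂ _∨_ (eval-subst φ x y) (eval-subst ψ x y)

-- Quantifying over the continuation `w` says at once what is written for `u` and that the
-- transducer ends in phase `token`, so translations can be concatenated.
record Translates (ρ : Response) (u v : List Bool) : Set where
  constructor translation
  field translate : ∀ w → transduce ρ token (u ++ w) ≡ v ++ transduce ρ token w

open Translates

module _ {ρ : Response} where

  translates-++ : ∀ {u u′ v v′} → Translates ρ u v → Translates ρ u′ v′ → Translates ρ (u ++ u′) (v ++ v′)
  translate (translates-++ {u} {u′} {v} {v′} p q) w = begin
    transduce ρ token ((u ++ u′) ++ w)  ≡⟨ cong (transduce ρ token) (List.++-assoc u u′ w) ⟩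
    transduce ρ token (u ++ u′ ++ w)    ≡⟨ translate p (u′ ++ w) ⟩
    v ++ transduce ρ token (u′ ++ w)    ≡⟨ cong (v ++_) (translate q w) ⟩
    v ++ v′ ++ transduce ρ token w      ≡⟨ List.++-assoc v v′ _ ⟨
    (v ++ v′) ++ transduce ρ token w    ∎
    where open ≡-Reasoning

  module _ (σ : Fin m → Formula m′ n′) (τ : Fin n → Formula m′ n′)
           (keeps-~ : Translates ρ (O ∷ O ∷ []) (O ∷ O ∷ []))
           (keeps-∧ : Translates ρ (O ∷ I ∷ []) (O ∷ I ∷ []))
           (keeps-∨ : Translates ρ (I ∷ O ∷ []) (I ∷ O ∷ []))
           (y-translates : ∀ j → Translates ρ (code {m} {n} y⟨ j ⟩) (code (τ j))) where

    -- The condition on x-variables concerns only those that occur: a clamped index is written like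
    -- the original only while it is small enough.
    code-translates : ∀ φ → AllX (λ i → Translates ρ (code {m} {n} x⟨ i ⟩) (code (σ i))) φ →
                      Translates ρ (code φ) (code (substitute σ τ φ))
    code-translates x⟨ i ⟩   p       = p
    code-translates y⟨ j ⟩   p       = y-translates j
    code-translates (~ φ)    p       = translates-++ (code-translates φ p) keeps-~
    code-translates (φ ∧′ ψ) (p , q) =
      translates-++ (code-translates φ p) (translates-++ (code-translates ψ q) keeps-∧)
    code-translates (φ ∨′ ψ) (p , q) =
      translates-++ (code-translates φ p) (translates-++ (code-translates ψ q) keeps-∨)

translates-all : ∀ {ρ u v} → Translates ρ u v → transduce ρ token u ≡ v
translates-all {ρ} {u} {v} p = begin
  transduce ρ token u         ≡⟨ cong (transduce ρ token) (List.++-identityʳ u) ⟨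
  transduce ρ token (u ++ []) ≡⟨ translate p [] ⟩
  v ++ []                     ≡⟨ List.++-identityʳ v ⟩
  v                           ∎
  where open ≡-Reasoning

eval-local : ∀ φ (x x′ : Vec Bool m) (y : Vec Bool n) →
             AllX (λ i → lookup x i ≡ lookup x′ i) φ → eval φ x y ≡ eval φ x′ y
eval-local x⟨ i ⟩   x x′ y p       = p
eval-local y⟨ j ⟩   x x′ y p       = refl
eval-local (~ φ)    x x′ y p       = cong not (eval-local φ x x′ y p)
eval-local (φ ∧′ ψ) x x′ y (p , q) = cong₂ _∧_ (eval-local φ x x′ y p) (eval-local ψ x x′ y q)
eval-local (φ ∨′ ψ) x x′ y (p , q) = cong₂ _∨_ (eval-local φ x x′ y p) (eval-local ψ x x′ y q)

module _ (f : Vec Bool (suc m) → Vec Bool n → Bool) where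

  Certified : Vec Bool (suc m) → Set
  Certified x = ∀ y → f x y ≡ true

  uVAL₂-unique : ∀ x → Certified x → (∀ x′ → Certified x′ → x ≡ x′) → uVAL₂ f ≡ ⁅ head x ⁆
  uVAL₂-unique x p u with unique? (λ x → all? λ y → f x y Bool.≟ true)
  ... | yes (x′ , p′ , _) = cong (⁅_⁆ ∘ head) (sym (u x′ p′))
  ... | no ¬u             = ⊥-elim (¬u (x , p , λ {x′} → u x′))

  uVAL₂-cases : uVAL₂ f ≡ full ⊎ ∃ λ x → Certified x × (∀ x′ → Certified x′ → x ≡ x′)
  uVAL₂-cases with unique? (λ x → all? λ y → f x y Bool.≟ true)
  ... | yes (x , p , u) = inj₂ (x , p , λ x′ → u {x′})
  ... | no _            = inj₁ refl

-- Complementing the first argument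

negation : Σ⁺ → Σ⁺
negation (b ∷ w) = b ∷ transduce negating (next-phase pre b) w

negation-computes : Computes negation
negation-computes = computes negation (λ { (_ ∷ _) → refl }) (transducer-appends negating pre)

complemented : Formula m n → Formula m n
complemented = substitute (λ i → ~ x⟨ i ⟩) y⟨_⟩

complemented-code : (φ : Formula m n) → transduce negating token (code φ) ≡ code (complemented φ)
complemented-code φ = translates-all (code-translates _ _ (translation λ _ → refl) (translation λ _ → refl)
  (translation λ _ → refl)
  (λ j → translation λ w → cong (λ v → I ∷ I ∷ I ∷ v) (varY-ones (toℕ j) w))
  φ (AllX-universal (λ i → translation λ w → cong (λ v → I ∷ I ∷ O ∷ v) (varX-ones (toℕ i) w)) φ))
  where
  varX-ones : ∀ i w → transduce negating varX ((ones i ++ O ∷ []) ++ w) ≡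
                      ((ones i ++ O ∷ []) ++ O ∷ O ∷ []) ++ transduce negating token w
  varX-ones zero    w = refl
  varX-ones (suc i) w = cong (I ∷_) (varX-ones i w)
  varY-ones : ∀ i w → transduce negating varY ((ones i ++ O ∷ []) ++ w) ≡
                      (ones i ++ O ∷ []) ++ transduce negating token w
  varY-ones zero    w = refl
  varY-ones (suc i) w = cong (I ∷_) (varY-ones i w)

number-negating-pre : ∀ n w {k v} → number n w ≡ just (k , v) →
                      number n (transduce negating pre w) ≡ just (k , transduce negating num v)
number-negating-pre n (I ∷ O ∷ w) p    = number-negating-pre _ w p
number-negating-pre n (I ∷ I ∷ w) p    = number-negating-pre _ w p
number-negating-pre n (O ∷ w)     refl = refl

number-negating-num : ∀ n w {k v} → number n w ≡ just (k , v) →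
                      number n (transduce negating num w) ≡ just (k , transduce negating token v)
number-negating-num n (I ∷ O ∷ w) p    = number-negating-num _ w p
number-negating-num n (I ∷ I ∷ w) p    = number-negating-num _ w p
number-negating-num n (O ∷ w)     refl = refl

parse-code-[] : (φ : Formula m n) → parse (code φ) [] ≡ just φ
parse-code-[] φ = trans (cong (λ w → parse w []) (sym (List.++-identityʳ (code φ)))) (parse-code φ [] [])

decode₂-just : ∀ w {m m′ u v} {φ : Formula (suc m) m′} → number 0 (toList w) ≡ just (suc m , v) →
               number 0 v ≡ just (m′ , u) → parse u [] ≡ just φ → decode₂ w ≡ just (m , m′ , φ)
decode₂-just w p q r rewrite p | q | r = refl

decode₂-negation : ∀ w {m m′ φ} → decode₂ w ≡ just (m , m′ , φ) →
                   decode₂ (negation w) ≡ just (m , m′ , complemented φ)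
decode₂-negation w@(b ∷ bs) p with number 0 (toList w) in e₁
... | just (suc m , v) with number 0 v in e₂
... | just (m′ , u) with parse {suc m} {m′} u [] in e₃
decode₂-negation w@(b ∷ bs) refl | just (suc m , v) | just (m′ , u) | just φ =
  decode₂-just (negation w) (number-negating-pre 0 (toList w) e₁) (number-negating-num 0 v e₂)
    (trans (cong (λ u → parse (transduce negating token u) []) (parse-sound u [] e₃))
      (trans (cong (λ u → parse u []) (complemented-code φ)) (parse-code-[] (complemented φ))))

complement : Vec Bool n → Vec Bool n
complement = Vec.map not

complement-involutive : (x : Vec Bool n) → complement (complement x) ≡ x
complement-involutive x =
  trans (sym (Vec.map-∘ not not x)) (trans (Vec.map-cong Bool.not-involutive x) (Vec.map-id x))

eval-complemented : ∀ (φ : Formula m n) x y → eval (complemented φ) x y ≡ eval φ (complement x) y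
eval-complemented φ x y = trans (eval-subst _ _ φ x y)
  (cong₂ (eval φ) (trans (Vec.tabulate-∘ not (lookup x)) (cong complement (Vec.tabulate∘lookup x)))
                  (Vec.tabulate∘lookup y))

-- Complementation is an involution on the first arguments and carries the unique certified one
-- along. The value `full` forms a case of its own since it contains every answer.
uVAL₂-complemented : (φ : Formula (suc m) n) →
                     uVAL₂ (eval φ) ≡ full ⊎ uVAL₂ (eval (complemented φ)) ≡ neg (uVAL₂ (eval φ))
uVAL₂-complemented φ with uVAL₂-cases (eval φ)
... | inj₁ p                  = inj₁ p
... | inj₂ (x@(_ ∷ _) , p , u) = inj₂ (begin
  uVAL₂ (eval (complemented φ))   ≡⟨ uVAL₂-unique (eval (complemented φ)) (complement x) p′ u′ ⟩
  ⁅ head (complement x) ⁆         ≡⟨⟩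
  neg ⁅ head x ⁆                  ≡⟨ cong neg (uVAL₂-unique (eval φ) x p u) ⟨
  neg (uVAL₂ (eval φ))            ∎)
  where
  open ≡-Reasoning
  p′ : Certified (eval (complemented φ)) (complement x)
  p′ y = trans (eval-complemented φ _ y) (trans (cong (λ z → eval φ z y) (complement-involutive x)) (p y))
  u′ : ∀ x′ → Certified (eval (complemented φ)) x′ → complement x ≡ x′
  u′ x′ q = trans (cong complement (u (complement x′) λ y → trans (sym (eval-complemented φ x′ y)) (q y)))
                  (complement-involutive x′)

UVAL₂-negation : ∀ w → UVAL₂ w ≡ full ⊎ UVAL₂ (negation w) ≡ neg (UVAL₂ w)
UVAL₂-negation w with decode₂ w in e
... | nothing = inj₁ refl
... | just (m , m′ , φ) rewrite decode₂-negation w e = uVAL₂-complemented φ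

full-⊇ : ∀ {S T} → S ≡ full → S ⊇ T
full-⊇ refl b _ = any

neg-involutive : ∀ S → neg (neg S) ≡ S
neg-involutive ⁅ b ⁆ = cong ⁅_⁆ (Bool.not-involutive b)
neg-involutive full  = refl

neg-UVAL₂-⊇ : ∀ w → neg (UVAL₂ w) ⊇ UVAL₂ (negation w)
neg-UVAL₂-⊇ w with UVAL₂-negation w
... | inj₁ p = full-⊇ (cong neg p)
... | inj₂ p = λ b → subst (b ∈_) p

UVAL₂-⊇-neg : ∀ w → UVAL₂ w ⊇ neg (UVAL₂ (negation w))
UVAL₂-⊇-neg w with UVAL₂-negation w
... | inj₁ p = full-⊇ p
... | inj₂ p = λ b → subst (b ∈_) (trans (cong neg p) (neg-involutive (UVAL₂ w)))

-- Appending `negation` to the reduction serves both inclusions, because `neg` is an involution.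
self-complementary : ¬[ UVAL₂ ] ≐ [ UVAL₂ ]
self-complementary =
  (λ (μ , μ-poly , φ⊇) → negation ∘ μ , polytime-∘ μ-poly negation-computes ,
     λ x b → φ⊇ x b ∘ neg-UVAL₂-⊇ (μ x) b) ,
  (λ (μ , μ-poly , φ⊇) → negation ∘ μ , polytime-∘ μ-poly negation-computes ,
     λ x b → φ⊇ x b ∘ UVAL₂-⊇-neg (μ x) b)

-- The lexicographic order as a formula

-- Either a ≥ b and the tails compare, or a > b. The tails stand first because in postfix notation
-- their code then begins the whole code.
leq : Vec Bool n → Vec Bool n → Bool
leq []      []      = true
leq (b ∷ y) (a ∷ x) = (leq y x ∧ (a ∨ not b)) ∨ (a ∧ not b)

leq-complete : (y x : Vec Bool n) → y ≤ₗₑₓ x → leq y x ≡ true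
leq-complete []          []          _                       = refl
leq-complete (false ∷ y) (true ∷ x)  _                       = Bool.∨-zeroʳ _
leq-complete (false ∷ y) (false ∷ x) (Lex.next _ p)
  rewrite leq-complete y x p = refl
leq-complete (true ∷ y)  (true ∷ x)  (Lex.next _ p)
  rewrite leq-complete y x p = refl
leq-complete (true ∷ y)  (false ∷ x) (Lex.this () _)
leq-complete (true ∷ y)  (false ∷ x) (Lex.next () _)

leq-tail : ∀ {b} → (b ∧ true) ∨ false ≡ true → b ≡ true
leq-tail {true} _ = refl

leq-antisym : (y x : Vec Bool n) → leq y x ≡ true → leq x y ≡ true → x ≡ y
leq-antisym []          []          p q = refl
leq-antisym (false ∷ y) (false ∷ x) p q = cong (false ∷_) (leq-antisym y x (leq-tail p) (leq-tail q))
leq-antisym (true ∷ y)  (true ∷ x)  p q = cong (true ∷_) (leq-antisym y x (leq-tail p) (leq-tail q))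
leq-antisym (true ∷ y)  (false ∷ x) p q with leq y x
leq-antisym (true ∷ y)  (false ∷ x) () q | false
leq-antisym (true ∷ y)  (false ∷ x) () q | true
leq-antisym (false ∷ y) (true ∷ x)  p q with leq x y
leq-antisym (false ∷ y) (true ∷ x)  p () | false
leq-antisym (false ∷ y) (true ∷ x)  p () | true

≥-at >-at : Fin n → Formula n n
≥-at i = x⟨ i ⟩ ∨′ (~ y⟨ i ⟩)
>-at i = x⟨ i ⟩ ∧′ (~ y⟨ i ⟩)

-- `ι` lists the compared positions, most significant first. Formulas have no constants, so the
-- empty comparison is a tautology in the first variable.
lexFormula : ∀ k → (Fin k → Fin (suc n)) → Formula (suc n) (suc n)
lexFormula zero    ι = x⟨ zero ⟩ ∨′ (~ x⟨ zero ⟩)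
lexFormula (suc k) ι = (lexFormula k (ι ∘ suc) ∧′ ≥-at (ι zero)) ∨′ >-at (ι zero)

eval-lexFormula : ∀ k (ι : Fin k → Fin (suc n)) x y →
                  eval (lexFormula k ι) x y ≡ leq (tabulate (lookup y ∘ ι)) (tabulate (lookup x ∘ ι))
eval-lexFormula zero    ι x y = Bool.∨-inverseʳ (lookup x zero)
eval-lexFormula (suc k) ι x y =
  cong (λ b → (b ∧ (a ∨ not c)) ∨ (a ∧ not c)) (eval-lexFormula k (ι ∘ suc) x y)
  where
  a c : Bool
  a = lookup x (ι zero)
  c = lookup y (ι zero)

trueCode : List Bool
trueCode = code {1} {1} (x⟨ zero ⟩ ∨′ (~ x⟨ zero ⟩))

-- `stepTemplate` is what the code gains at its end when a more significant position is put in
-- front.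
variableX variableY template≥ template> stepTemplate : List (Maybe Bool)
variableX = just I ∷ just I ∷ just O ∷ nothing ∷ just O ∷ []
variableY = just I ∷ just I ∷ just I ∷ nothing ∷ just O ∷ []
template≥ = variableX ++ (variableY ++ ⌜ O ∷ O ∷ [] ⌝) ++ ⌜ I ∷ O ∷ [] ⌝
template> = variableX ++ (variableY ++ ⌜ O ∷ O ∷ [] ⌝) ++ ⌜ O ∷ I ∷ [] ⌝
stepTemplate     = (template≥ ++ ⌜ O ∷ I ∷ [] ⌝) ++ template> ++ ⌜ I ∷ O ∷ [] ⌝

render-++ : ∀ i ps qs → render i (ps ++ qs) ≡ render i ps ++ render i qs
render-++ i = List.concatMap-++ _

render-step : ∀ (i : Fin n) →
              render (toℕ i) stepTemplate ≡ (code (≥-at i) ++ O ∷ I ∷ []) ++ code (>-at i) ++ I ∷ O ∷ []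
render-step i = begin
  render d stepTemplate
    ≡⟨ render-++ d (template≥ ++ ⌜ O ∷ I ∷ [] ⌝) (template> ++ ⌜ I ∷ O ∷ [] ⌝) ⟩
  render d (template≥ ++ ⌜ O ∷ I ∷ [] ⌝) ++ render d (template> ++ ⌜ I ∷ O ∷ [] ⌝)
    ≡⟨ cong₂ _++_ (render-++ d template≥ ⌜ O ∷ I ∷ [] ⌝) (render-++ d template> ⌜ I ∷ O ∷ [] ⌝) ⟩
  (render d template≥ ++ O ∷ I ∷ []) ++ render d template> ++ I ∷ O ∷ []
    ≡⟨ cong₂ (λ u v → (u ++ O ∷ I ∷ []) ++ v ++ I ∷ O ∷ [])
         (template-code (I ∷ O ∷ [])) (template-code (O ∷ I ∷ [])) ⟩
  (code (≥-at i) ++ O ∷ I ∷ []) ++ code (>-at i) ++ I ∷ O ∷ [] ∎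
  where
  open ≡-Reasoning
  d : ℕ
  d = toℕ i
  template-code : ∀ v → render d (variableX ++ (variableY ++ ⌜ O ∷ O ∷ [] ⌝) ++ ⌜ v ⌝) ≡
               render d variableX ++ (render d variableY ++ O ∷ O ∷ []) ++ v
  template-code v = trans (render-++ d variableX ((variableY ++ ⌜ O ∷ O ∷ [] ⌝) ++ ⌜ v ⌝))
    (cong (render d variableX ++_) (trans (render-++ d (variableY ++ ⌜ O ∷ O ∷ [] ⌝) ⌜ v ⌝)
      (cong₂ _++_ (render-++ d variableY ⌜ O ∷ O ∷ [] ⌝) (render-just d v))))

-- `renderAll` counts down, so the code for the positions from `d` on, continued by the blocks of
-- those below `d`, is the whole string. The offset `d` carries the induction; it is 0 in the
-- application.
lexFormula-code : ∀ k d (ι : Fin k → Fin (suc n)) → (∀ i → toℕ (ι i) ≡ d + toℕ i) →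
                  code (lexFormula k ι) ++ renderAll stepTemplate d ≡ trueCode ++ renderAll stepTemplate (d + k)
lexFormula-code zero    d ι p = cong (λ k → trueCode ++ renderAll stepTemplate k) (sym (+-identityʳ d))
lexFormula-code (suc k) d ι p = begin
  ((le ++ code (≥-at i) ++ O ∷ I ∷ []) ++ code (>-at i) ++ I ∷ O ∷ []) ++ renderAll stepTemplate d
    ≡⟨ cong (_++ renderAll stepTemplate d) (List.++-assoc le (code (≥-at i) ++ O ∷ I ∷ []) _) ⟩
  (le ++ (code (≥-at i) ++ O ∷ I ∷ []) ++ code (>-at i) ++ I ∷ O ∷ []) ++ renderAll stepTemplate d
    ≡⟨ cong (λ v → (le ++ v) ++ renderAll stepTemplate d) (render-step i) ⟨
  (le ++ render (toℕ i) stepTemplate) ++ renderAll stepTemplate d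
    ≡⟨ cong (λ j → (le ++ render j stepTemplate) ++ renderAll stepTemplate d) (trans (p zero) (+-identityʳ d)) ⟩
  (le ++ render d stepTemplate) ++ renderAll stepTemplate d
    ≡⟨ List.++-assoc le (render d stepTemplate) _ ⟩
  le ++ renderAll stepTemplate (suc d)
    ≡⟨ lexFormula-code k (suc d) (ι ∘ suc) (λ i → trans (p (suc i)) (+-suc d (toℕ i))) ⟩
  trueCode ++ renderAll stepTemplate (suc d + k)
    ≡⟨ cong (λ k → trueCode ++ renderAll stepTemplate k) (+-suc d k) ⟨
  trueCode ++ renderAll stepTemplate (d + suc k) ∎
  where
  open ≡-Reasoning
  i  = ι zero
  le = code (lexFormula k (ι ∘ suc))

-- Changing the number of variables

-- The minimum of the index and `n`. It fixes 0, so `resize` keeps the first bit, and it fixes every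
-- index that a short enough formula can contain.
clamp : Fin (suc m) → Fin (suc n)
clamp                 zero    = zero
clamp {n = zero}      (suc i) = zero
clamp {suc m} {suc n} (suc i) = suc (clamp i)

toℕ-clamp : ∀ (i : Fin (suc m)) → toℕ i < suc n → toℕ (clamp {n = n} i) ≡ toℕ i
toℕ-clamp                 zero    p       = refl
toℕ-clamp {suc m} {suc n} (suc i) (s≤s p) = cong suc (toℕ-clamp i p)
toℕ-clamp {suc m} {zero}  (suc i) (s≤s ())

clamp-clamp : ∀ (i : Fin (suc m)) → toℕ i < suc n → clamp (clamp {n = n} i) ≡ i
clamp-clamp {m} {n} i p = toℕ-injective (trans
  (toℕ-clamp (clamp i) (subst (_< suc m) (sym (toℕ-clamp i p)) (toℕ<n i))) (toℕ-clamp i p))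

resize : Vec Bool (suc m) → Vec Bool (suc n)
resize x = tabulate (lookup x ∘ clamp)

head-resize : (x : Vec Bool (suc m)) → head (resize {n = n} x) ≡ head x
head-resize (_ ∷ _) = refl

copies-ones : ∀ ρ → (∀ b → ρ varX b ≡ (just b , 0F)) → ∀ i w →
              transduce ρ varX ((ones i ++ O ∷ []) ++ w) ≡ (ones i ++ O ∷ []) ++ transduce ρ token w
copies-ones ρ p zero    w rewrite p O = refl
copies-ones ρ p (suc i) w rewrite p I = cong (I ∷_) (copies-ones ρ p i w)

skips-number : ∀ ρ → (∀ b → ρ num b ≡ (nothing , 0F)) → (∀ b → ρ numD b ≡ (nothing , 0F)) →
               ∀ n w {k v} → number n w ≡ just (k , v) → transduce ρ num w ≡ transduce ρ token v
skips-number ρ p q n (I ∷ O ∷ w) e    rewrite p I | q O = skips-number ρ p q _ w e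
skips-number ρ p q n (I ∷ I ∷ w) e    rewrite p I | q I = skips-number ρ p q _ w e
skips-number ρ p q n (O ∷ w)     refl rewrite p O       = refl

head-mono : ∀ {x y : Vec Bool (suc n)} → y ≤ₗₑₓ x → head y Bool.≤ head x
head-mono (Lex.this Bool.f<t _)  = Bool.f≤t
head-mono (Lex.next refl _)      = Bool.b≤b

polytime-id : PolyTime id
polytime-id = record { extraTapes = 0 ; states = 1 ; start = 0F ; δ = λ _ _ → nothing } , 0 , 0 ,
  λ { (b ∷ bs) → 0 , _ , z≤n , halt refl , cong (b ∷_) (upToBlank-just bs) }
  where
  upToBlank-just : ∀ w → upToBlank ⌜ w ⌝ ≡ w
  upToBlank-just []      = refl
  upToBlank-just (b ∷ w) = cong (b ∷_) (upToBlank-just w)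

-- Maximality as a formula, and the reduction of MaxVAL

module _ {m} (n : ℕ) (φ : Formula (suc m) 0) where

  inX inY : Formula (suc n) (suc n)
  inX = substitute (x⟨_⟩ ∘ clamp) (λ ()) φ
  inY = substitute (y⟨_⟩ ∘ clamp) (λ ()) φ

  optimality : Formula (suc n) (suc n)
  optimality = inX ∧′ ((~ inY) ∨′ lexFormula (suc n) id)

  holds : Vec Bool (suc n) → Bool
  holds z = eval φ (resize z) []

  eval-optimality : ∀ x y → eval optimality x y ≡ holds x ∧ (not (holds y) ∨ leq y x)
  eval-optimality x y = cong₂ _∧_ (eval-subst _ _ φ x y)
    (cong₂ (λ b c → not b ∨ c) (eval-subst _ _ φ x y)
      (trans (eval-lexFormula (suc n) id x y) (cong₂ leq (Vec.tabulate∘lookup y) (Vec.tabulate∘lookup x))))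

  uVAL₂-optimality : ∀ z → IsMax holds z → uVAL₂ (eval optimality) ≡ ⁅ head z ⁆
  uVAL₂-optimality z (p , max) = uVAL₂-unique (eval optimality) z certified λ x c →
    -- A certified `x` is a model, so x ≤ z by maximality; its condition at y = z gives z ≤ x.
    let c′ = λ y → trans (sym (eval-optimality x y)) (c y)
        q  = Bool.∧-conicalˡ _ _ (c′ x)
    in leq-antisym x z (leq-complete x z (max x q))
         (subst (λ b → not b ∨ leq z x ≡ true) p (Bool.∧-conicalʳ _ _ (c′ z)))
    where
    certified : Certified (eval optimality) z
    certified y = trans (eval-optimality z y) (cong₂ _∧_ p below)
      where
      below : not (holds y) ∨ leq y z ≡ true
      below with holds y in e
      ... | false = refl
      ... | true  = leq-complete y z (max y e)

  module _ (short : ∣ code φ ∣ ≤ suc n) where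

    bounded : AllX (λ i → toℕ i < suc n) φ
    bounded = AllX-bounded φ short

    -- Resizing there and back restores every bit whose index occurs in `φ`, all of these being
    -- below `suc n`.
    holds-resize : ∀ x → holds (resize x) ≡ eval φ x []
    holds-resize x = eval-local φ _ x [] (AllX-map (λ i i< →
      trans (Vec.lookup∘tabulate (lookup (resize {n = n} x) ∘ clamp) i)
        (trans (Vec.lookup∘tabulate (lookup x ∘ clamp) (clamp i)) (cong (lookup x) (clamp-clamp i i<))))
      φ bounded)

    inX-code : transduce keeping token (code φ) ≡ code inX
    inX-code = translates-all (code-translates _ _ (translation λ _ → refl) (translation λ _ → refl)
      (translation λ _ → refl) (λ ()) φ (AllX-map (λ i i< → translation λ w →
        cong (λ v → I ∷ I ∷ O ∷ v) (trans (copies-ones keeping (λ _ → refl) (toℕ i) w)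
          (cong (λ k → (ones k ++ O ∷ []) ++ transduce keeping token w) (sym (toℕ-clamp i i<)))))
        φ bounded))

    inY-code : transduce x↦y token (code φ) ≡ code inY
    inY-code = translates-all (code-translates _ _ (translation λ _ → refl) (translation λ _ → refl)
      (translation λ _ → refl) (λ ()) φ (AllX-map (λ i i< → translation λ w →
        cong (λ v → I ∷ I ∷ I ∷ v) (trans (copies-ones x↦y (λ _ → refl) (toℕ i) w)
          (cong (λ k → (ones k ++ O ∷ []) ++ transduce x↦y token w) (sym (toℕ-clamp i i<)))))
        φ bounded))

    -- In both directions `resize` carries models to models and keeps the first bit, so the first
    -- bit of each maximum is at most that of the other.
    maxVAL-⊇-optimality : maxVAL (λ x → eval φ x []) ⊇ uVAL₂ (eval optimality)
    maxVAL-⊇-optimality with sat? (λ x → eval φ x [])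
    ... | no _  = λ b _ → any
    ... | yes s with x , p , max ← maximum (λ x → eval φ x []) s
                with z , q , max′ ← maximum holds (resize x , trans (holds-resize x) p) =
      λ b → subst (b ∈_) (trans (uVAL₂-optimality z (q , max′)) (cong ⁅_⁆ (Bool.≤-antisym z≤x x≤z)))
      where
      x≤z : head x Bool.≤ head z
      x≤z = subst (Bool._≤ head z) (head-resize {n = n} x)
              (head-mono (max′ (resize x) (trans (holds-resize x) p)))
      z≤x : head z Bool.≤ head x
      z≤x = subst (Bool._≤ head x) (head-resize {n = m} z) (head-mono (max (resize z) q))

-- The leading 00 negates the copy of the formula in y, just before the order formula starts; the
-- closing 10 and 01 are the ∨ and the ∧ of `optimality`.
open Comparer (O ∷ O ∷ trueCode) stepTemplate (I ∷ O ∷ O ∷ I ∷ [])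

comparing : Σ⁺ → Σ⁺
comparing w = I ∷ List.drop 1 (List.concat (parts (toList w)))

comparing-computes : Computes comparing
comparing-computes = computes comparing (λ _ → refl) comparer-appends

parse-optimality : ∀ n (φ : Formula (suc m) 0) →
  parse (code (inX n φ) ++ code (inY n φ) ++ (O ∷ O ∷ trueCode) ++
         renderAll stepTemplate (suc n) ++ (I ∷ O ∷ O ∷ I ∷ []) ++ []) []
    ≡ just (optimality n φ)
parse-optimality n φ = begin
  parse (code (inX n φ) ++ code (inY n φ) ++ O ∷ O ∷ trueCode ++ R ++ end) []
    ≡⟨ parse-code (inX n φ) _ [] ⟩
  parse (code (inY n φ) ++ O ∷ O ∷ trueCode ++ R ++ end) (inX n φ ∷ [])
    ≡⟨ parse-code (inY n φ) _ _ ⟩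
  parse (trueCode ++ R ++ end) s
    ≡⟨ cong (λ w → parse w s) (List.++-assoc trueCode R end) ⟨
  parse ((trueCode ++ R) ++ end) s
    ≡⟨ cong (λ v → parse (v ++ end) s)
         (trans (sym (lexFormula-code (suc n) 0 id (λ _ → refl))) (List.++-identityʳ _)) ⟩
  parse (code lex ++ end) s
    ≡⟨ parse-code lex end s ⟩
  just (optimality n φ) ∎
  where
  open ≡-Reasoning
  R   = renderAll stepTemplate (suc n)
  end = I ∷ O ∷ O ∷ I ∷ []
  lex = lexFormula (suc n) id
  s   = ~ inY n φ ∷ inX n φ ∷ []

code-short : ∀ w {k v} {φ : Formula m n} → number 0 (toList w) ≡ just (k , v) → parse v [] ≡ just φ →
             ∣ code φ ∣ ≤ length w
code-short w {v = v} p q =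
  subst (λ u → ∣ u ∣ ≤ length w) (parse-sound v [] q) (number-length 0 (toList w) p)

decode₂-comparing : ∀ w {m v} {φ : Formula (suc m) 0} → number 0 (toList w) ≡ just (suc m , v) →
                    parse v [] ≡ just φ →
                    decode₂ (comparing w) ≡ just (_ , _ , optimality (List.length (List⁺.tail w)) φ)
decode₂-comparing w@(b ∷ bs) {v = v} {φ} p q =
  decode₂-just (comparing w) (number-encoding N _) (number-encoding N _)
    (trans (cong₂ (λ t u → parse (t ++ u ++ rest) [])
             (trans (skips-number keeping (λ _ → refl) (λ _ → refl) 0 (toList w) p)
               (trans (cong (transduce keeping token) v≡) (inX-code _ φ short)))
             (trans (skips-number x↦y (λ _ → refl) (λ _ → refl) 0 (toList w) p)
               (trans (cong (transduce x↦y token) v≡) (inY-code _ φ short))))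
           (parse-optimality _ φ))
  where
  N = length w
  rest = (O ∷ O ∷ trueCode) ++ renderAll stepTemplate N ++ (I ∷ O ∷ O ∷ I ∷ []) ++ []
  v≡ : v ≡ code φ
  v≡ = parse-sound v [] q
  short = code-short w p q

MaxVAL∝UVAL₂ : MaxVAL ∝ UVAL₂
-- Composing with the identity starts the machine on a plain input tape.
MaxVAL∝UVAL₂ = comparing , polytime-∘ polytime-id comparing-computes , correct
  where
  correct : ∀ w → MaxVAL w ⊇ UVAL₂ (comparing w)
  correct w with number 0 (toList w) in e₁
  ... | nothing           = λ _ _ → any
  ... | just (zero , _)   = λ _ _ → any
  ... | just (suc m , v) with parse {suc m} {0} v [] in e₂
  ...   | nothing = λ _ _ → any
  ...   | just φ rewrite decode₂-comparing w e₁ e₂ = maxVAL-⊇-optimality _ φ (code-short w e₁ e₂)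

theorem2 : (¬[ UVAL₂ ] ≐ [ UVAL₂ ]) × (MaxVAL ∝ UVAL₂)
theorem2 = self-complementary , MaxVAL∝UVAL₂
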